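{- Let $\mathcal{C}$ be a completion-post-effective and $\infty$-completion-effective class of very-WSTS. Then for every $\mathcal{S}=(X,\xrightarrow{\Sigma},\le)\in\mathcal{C}$ and every $x\in X$, the ideal decomposition of $\downarrow\mathrm{Post}^*(x)$ can be computed. In particular, the coverability problem for $\mathcal{C}$ is decidable.
   Context: A (labeled, ordered) transition system is $\mathcal{S}=(X,\xrightarrow{\Sigma},\le)$: $X$ a set, $\Sigma$ finite, $\xrightarrow{a}\subseteq X\times X$ for $a\in\Sigma$, $\le$ a quasi-ordering; relations extend to words. $\mathrm{Post}(x,w)=\{y:x\xrightarrow{w}y\}$, $\mathrm{Post}^*(x)=\bigcup_{w\in\Sigma^*}\mathrm{Post}(x,w)$, extended to sets by union; $\downarrow D=\{x:\exists y\in D,\ x\le y\}$. WSTS: $\le$ wqo and monotone ($x\xrightarrow{a}y$, $x'\ge x$ imply $x'\xrightarrow{w}y'\ge y$ for some $w$). Strong monotonicity: $x\xrightarrow{a}y$, $x'\ge x$ imply $x'\xrightarrow{a}y'$ for some $y'\ge y$; strong-strict: additionally $x'>x$ yields such $y'>y$. Deterministic: at most one $a$-successor. Ideal: nonempty downward-closed directed subset; $\mathrm{Idl}(X)$ the set of ideals. Ideal decomposition of downward-closed $D$ (in a wqo): the finite set of $\subseteq$-maximal ideals included in $D$; $D$ is their union. Completion $\widehat{\mathcal{S}}=(\mathrm{Idl}(X),\Rightarrow_\Sigma,\subseteq)$ with $I\xRightarrow{a}J$ iff $J$ is in the ideal decomposition of $\downarrow\mathrm{Post}(I,a)$. If deterministic,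 $w(I)$ is the unique $J$ with $I\xRightarrow{w}J$. For $w\in\Sigma^+$: $w^\infty(I)=\bigcup_kw^k(I)$ if $I\subset w(I)$, else $I$. Levels: $\mathrm{Idl}_0(X)=\mathrm{Idl}(X)$, $\mathrm{Idl}_n(X)$ = set of unions of strictly increasing sequences in $\mathrm{Idl}_{n-1}(X)$; finitely many levels if some $\mathrm{Idl}_n(X)=\emptyset$. A very-WSTS is a WSTS with strong monotonicity whose completion is a deterministic WSTS ($\subseteq$ a wqo on ideals, monotone) with strong-strict monotonicity, and $\mathrm{Idl}(X)$ has finitely many levels. A class of WSTS is completion-post-effective if (1) ideals can be effectively represented and manipulated, (2) inclusion of ideals is decidable, and (3) the successors of an ideal in the completion, $\{J: I\xRightarrow{a}J\}$, are computable for every ideal $I$ and $a$. It is $\infty$-completion-effective if $w^\infty(I)$ is computable for every ideal $I$ and word $w$. Coverability problem: given $\mathcal{S}$ and $x,y\in X$, decide whether there is $z\ge y$ with $z\in\mathrm{Post}^*(x)$. -}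

module Defs where

open import Data.Fin.Base using (Fin; toℕ)
open import Data.List.Base using (List; []; _∷_; map; concat; replicate)
open import Data.List.Relation.Binary.Pointwise using (Pointwise)
open import Data.List.Relation.Unary.Any using (Any)
open import Data.Nat.Base using (ℕ; zero; suc; _*_; _^_; _<_)
open import Data.Product.Base using (Σ; ∃; ∃₂; _×_; _,_)
open import Data.Sum.Base using (_⊎_)
open import Data.Unit.Polymorphic.Base using (⊤)
open import Data.Vec.Base using (Vec; []; _∷_; lookup)
import Data.Vec.Relation.Binary.Pointwise.Inductive as Vec
open import Function.Bundles using (_⇔_)
open import Level using (Level; 0ℓ; _⊔_) renaming (suc to lsuc)
open import Relation.Binary.Bundles using (Preorder; Setoid)
open import Relation.Binary.Core using (Rel; REL)
open import Relation.Binary.Definitions using (_Respects₂_; _Respectsʳ_)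
import Relation.Binary.Construct.On as On
open import Relation.Binary.PropositionalEquality using (setoid)
open import Relation.Nullary.Negation using (¬_)
open import Relation.Unary using (Pred; _∈_; _⊆_; _⊂_; _≐_; ⋃; Satisfiable)
open import Relation.Unary.Relation.Binary.Subset using (⊆-preorder)

private
  variable
    a ℓ ℓ′ : Level
    m n : ℕ

-- The set of states is a setoid (the underlying equality of the preorder),
-- so that the completion, whose states are ideals up to extensional
-- equality, is again a transition system.
record TransitionSystem (a ℓ ℓ′ : Level) : Set (lsuc (a ⊔ ℓ ⊔ ℓ′)) where
  field
    states : Preorder a ℓ ℓ
    ∣Σ∣    : ℕ

  open Preorder states public using (_≈_; _≲_) renaming (Carrier to State)

  Letter : Set
  Letter = Fin ∣Σ∣

  Word : Set
  Word = List Letter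

  field
    step      : Letter → Rel State ℓ′
    step-resp : ∀ b → step b Respects₂ _≈_

  infix 4 _⟶[_]_ _≺_

  data _⟶[_]_ : State → Word → State → Set (a ⊔ ℓ ⊔ ℓ′) where
    ε   : ∀ {x y} → x ≈ y → x ⟶[ [] ] y
    _∷_ : ∀ {b w x y z} → step b x y → y ⟶[ w ] z → x ⟶[ b ∷ w ] z

  _≺_ : Rel State ℓ
  x ≺ y = x ≲ y × ¬ (y ≲ x)

  Post : ∀ {p} → Pred State p → Letter → Pred State (a ⊔ ℓ′ ⊔ p)
  Post D b y = ∃ λ x → x ∈ D × step b x y

  Post* : State → Pred State (a ⊔ ℓ ⊔ ℓ′)
  Post* x y = ∃ λ w → x ⟶[ w ] y

  ↓ : ∀ {p} → Pred State p → Pred State (a ⊔ ℓ ⊔ p)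
  ↓ D x = ∃ λ y → y ∈ D × x ≲ y

  Coverable : State → State → Set (a ⊔ ℓ ⊔ ℓ′)
  Coverable x y = ∃ λ z → y ≲ z × z ∈ Post* x

  WellQuasiOrdered : Set (a ⊔ ℓ)
  WellQuasiOrdered =
    ∀ (f : ℕ → State) → ∃₂ λ i j → i < j × f i ≲ f j

  Monotone : Set (a ⊔ ℓ ⊔ ℓ′)
  Monotone = ∀ {b x y x′} → step b x y → x ≲ x′ →
             ∃₂ λ w y′ → x′ ⟶[ w ] y′ × y ≲ y′

  StronglyMonotone : Set (a ⊔ ℓ ⊔ ℓ′)
  StronglyMonotone = ∀ {b x y x′} → step b x y → x ≲ x′ →
                     ∃ λ y′ → step b x′ y′ × y ≲ y′

  StronglyStrictlyMonotone : Set (a ⊔ ℓ ⊔ ℓ′)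
  StronglyStrictlyMonotone =
    StronglyMonotone ×
    (∀ {b x y x′} → step b x y → x ≺ x′ → ∃ λ y′ → step b x′ y′ × y ≺ y′)

  Deterministic : Set (a ⊔ ℓ ⊔ ℓ′)
  Deterministic = ∀ {b x y z} → step b x y → step b x z → y ≈ z

  IsWSTS : Set (a ⊔ ℓ ⊔ ℓ′)
  IsWSTS = WellQuasiOrdered × Monotone

module _ (P : Preorder 0ℓ 0ℓ 0ℓ) where

  open Preorder P

  record Ideal : Set₁ where
    field
      members    : Pred Carrier 0ℓ
      inhabited  : Satisfiable members
      downClosed : ∀ {x y} → x ≲ y → y ∈ members → x ∈ members
      directed   : ∀ {x y} → x ∈ members → y ∈ members →
                   ∃ λ z → z ∈ members × x ≲ z × y ≲ z

  open Ideal public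

  Idl : Preorder (lsuc 0ℓ) 0ℓ 0ℓ
  Idl = On.preorder (⊆-preorder Carrier 0ℓ) members

  principal : Carrier → Ideal
  principal x = record
    { members    = _≲ x
    ; inhabited  = x , refl
    ; downClosed = trans
    ; directed   = λ y≲x z≲x → x , refl , y≲x , z≲x
    }

  -- The set of maximal ideals included in D.
  IdealDecomposition : ∀ {p} → Pred Carrier p → Pred Ideal (lsuc 0ℓ ⊔ p)
  IdealDecomposition D J =
    members J ⊆ D ×
    (∀ K → members K ⊆ D → members J ⊆ members K → members K ⊆ members J)

  IdlLevel : ℕ → Pred Ideal (lsuc 0ℓ)
  IdlLevel zero    I = ⊤
  IdlLevel (suc n) I = Σ (ℕ → Ideal) λ f →
    (∀ k → f k ∈ IdlLevel n) ×
    (∀ k → members (f k) ⊂ members (f (suc k))) ×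
    (members I ≐ ⋃[ k ∶ ℕ ] members (f k))

  FinitelyManyLevels : Set₁
  FinitelyManyLevels = ∃ λ n → ∀ I → ¬ (I ∈ IdlLevel n)

System : Set₁
System = TransitionSystem 0ℓ 0ℓ 0ℓ

module _ (S : System) where

  open TransitionSystem S

  StateIdeal : Set₁
  StateIdeal = Ideal states

  completionStep : Letter → Rel StateIdeal (lsuc 0ℓ)
  completionStep b I J =
    J ∈ IdealDecomposition states (↓ (Post (members I) b))

  completion : TransitionSystem (lsuc 0ℓ) 0ℓ (lsuc 0ℓ)
  completion = record
    { states    = Idl states
    ; ∣Σ∣       = ∣Σ∣
    ; step      = completionStep
    ; step-resp = λ b →
        (λ (J⊆K , K⊆J) (J⊆D , max) →
          (λ x∈K → J⊆D (K⊆J x∈K)) ,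
          (λ L L⊆D K⊆L x∈L → J⊆K (max L L⊆D (λ y∈J → K⊆L (J⊆K y∈J)) x∈L))) ,
        (λ (I⊆H , H⊆I) (J⊆D , max) →
          (λ x∈J → enlarge I⊆H (J⊆D x∈J)) ,
          (λ L L⊆D → max L (λ x∈L → enlarge H⊆I (L⊆D x∈L))))
    }
    where
    enlarge : ∀ {b} {D E : Pred State 0ℓ} → D ⊆ E → ↓ (Post D b) ⊆ ↓ (Post E b)
    enlarge D⊆E (y , (z , z∈D , z→y) , x≲y) = y , (z , D⊆E z∈D , z→y) , x≲y

  open TransitionSystem completion
    using () renaming (_⟶[_]_ to _⟹[_]_; _≺_ to _⊊_)

  -- The union of the iterates wᵏ(I), where wᵏ(I) is the ideal J reached from I
  -- by reading k copies of w.
  ⋃-iterates : Word → StateIdeal → Pred State (lsuc 0ℓ)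
  ⋃-iterates w I x = ∃₂ λ k J →
    (I ⟹[ concat (replicate k w) ] J) × x ∈ members J

  -- I ⊂ w(I), which includes that w(I) is defined.
  Increases : Word → StateIdeal → Set₁
  Increases w I = ∃ λ J → (I ⟹[ w ] J) × I ⊊ J

  -- K = w^∞(I)
  IsAcceleration : Word → StateIdeal → StateIdeal → Set₁
  IsAcceleration w I K =
    (Increases w I × (members K ≐ ⋃-iterates w I)) ⊎
    (¬ Increases w I × (members K ≐ members I))

  IsVeryWSTS : Set₁
  IsVeryWSTS =
    IsWSTS ×
    StronglyMonotone ×
    TransitionSystem.IsWSTS completion ×
    TransitionSystem.Deterministic completion ×
    TransitionSystem.StronglyStrictlyMonotone completion ×
    FinitelyManyLevels states

data Rec : ℕ → Set where
  zero : Rec n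
  succ : Rec 1
  proj : Fin n → Rec n
  comp : Rec m → Vec (Rec n) m → Rec n
  prec : Rec n → Rec (suc (suc n)) → Rec (suc n)
  min  : Rec (suc n) → Rec n

infix 4 _[_]⇓_

data _[_]⇓_ : Rec n → Vec ℕ n → ℕ → Set where
  zero⇓  : {xs : Vec ℕ n} → zero [ xs ]⇓ 0
  succ⇓  : ∀ {x} → succ [ x ∷ [] ]⇓ suc x
  proj⇓  : ∀ {i} {xs : Vec ℕ n} → proj i [ xs ]⇓ lookup xs i
  comp⇓  : ∀ {f : Rec m} {gs : Vec (Rec n) m} {xs ys z} →
           Vec.Pointwise (λ g y → g [ xs ]⇓ y) gs ys →
           f [ ys ]⇓ z → comp f gs [ xs ]⇓ z
  prec⇓₀ : ∀ {g : Rec n} {h xs y} →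
           g [ xs ]⇓ y → prec g h [ 0 ∷ xs ]⇓ y
  prec⇓₁ : ∀ {g : Rec n} {h k xs y z} →
           prec g h [ k ∷ xs ]⇓ y → h [ k ∷ y ∷ xs ]⇓ z →
           prec g h [ suc k ∷ xs ]⇓ z
  min⇓   : ∀ {f : Rec (suc n)} {xs y} →
           (∀ {k} → k < y → ∃ λ z → f [ k ∷ xs ]⇓ suc z) →
           f [ y ∷ xs ]⇓ 0 → min f [ xs ]⇓ y

Decides : Rec n → Vec ℕ n → Set ℓ → Set ℓ
Decides f xs P = (P × f [ xs ]⇓ 1) ⊎ (¬ P × f [ xs ]⇓ 0)

-- A bijection between List ℕ and ℕ.
⌜_⌝ : List ℕ → ℕ
⌜ [] ⌝     = 0
⌜ x ∷ xs ⌝ = 2 ^ x * suc (2 * ⌜ xs ⌝)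

-- Every object has a code, and a number codes at most one object.
record Representation (A : Setoid a ℓ) : Set (lsuc 0ℓ ⊔ a ⊔ ℓ) where
  open Setoid A
  infix 4 _⊩_
  field
    _⊩_        : REL ℕ Carrier 0ℓ
    ⊩-resp     : _⊩_ Respectsʳ _≈_
    total      : ∀ x → ∃ λ c → c ⊩ x
    functional : ∀ {c x y} → c ⊩ x → c ⊩ y → x ≈ y

  Computes : Rec n → Vec ℕ n → Pred Carrier ℓ′ → Set (a ⊔ ℓ′)
  Computes f xs Q = ∃₂ λ c x → f [ xs ]⇓ c × c ⊩ x × x ∈ Q

  -- The output is the code of a list of codes of exactly the elements of Q;
  -- repetitions are allowed.
  ComputesFiniteSet : Rec n → Vec ℕ n → Pred Carrier ℓ′ → Set (a ⊔ ℓ ⊔ ℓ′)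
  ComputesFiniteSet f xs Q = ∃₂ λ cs ys →
    f [ xs ]⇓ ⌜ cs ⌝ × Pointwise _⊩_ cs ys × (∀ x → x ∈ Q ⇔ Any (x ≈_) ys)

stateSetoid : System → Setoid 0ℓ 0ℓ
stateSetoid S = Preorder.Eq.setoid (TransitionSystem.states S)

idealSetoid : System → Setoid (lsuc 0ℓ) 0ℓ
idealSetoid S = Preorder.Eq.setoid (Idl (TransitionSystem.states S))

-- A class of systems that can be inputs of algorithms: the systems and their
-- states are represented by numbers, and so is the (finite) alphabet.
record SystemClass : Set₁ where
  field
    Index     : Set
    system    : Index → System
    systemRep : Representation (setoid Index)
    stateRep  : ∀ i → Representation (stateSetoid (system i))

  infix 4 _codesSystem_
  _codesSystem_ : ℕ → Index → Set
  _codesSystem_ = Representation._⊩_ systemRep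

  codesState : ∀ i → ℕ → TransitionSystem.State (system i) → Set
  codesState i = Representation._⊩_ (stateRep i)

  field
    alphabet  : Rec 1
    alphabet⇓ : ∀ {s i} → s codesSystem i →
                alphabet [ s ∷ [] ]⇓ TransitionSystem.∣Σ∣ (system i)

-- All algorithms are uniform: they take a code of the system.
record CompletionPostEffective (𝒞 : SystemClass) : Set₁ where
  open SystemClass 𝒞
  field
    idealRep : ∀ i → Representation (idealSetoid (system i))

  codesIdeal : ∀ i → ℕ → StateIdeal (system i) → Set
  codesIdeal i = Representation._⊩_ (idealRep i)

  field
    -- Turns a code of a state x into a code of the ideal of states below x.
    principalCode  : Rec 2
    principalCode⇓ : ∀ {s i c x} → s codesSystem i → codesState i c x →
      Representation.Computes (idealRep i) principalCode (s ∷ c ∷ [])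
        (λ J → Setoid._≈_ (idealSetoid (system i)) J
                 (principal (TransitionSystem.states (system i)) x))

    inclusion  : Rec 3
    inclusion⇓ : ∀ {s i c d I J} → s codesSystem i →
      codesIdeal i c I → codesIdeal i d J →
      Decides inclusion (s ∷ c ∷ d ∷ [])
        (TransitionSystem._≲_ (completion (system i)) I J)

    post  : Rec 3
    post⇓ : ∀ {s i c I} → s codesSystem i → codesIdeal i c I → ∀ b →
      Representation.ComputesFiniteSet (idealRep i) post (s ∷ c ∷ toℕ b ∷ [])
        (TransitionSystem.step (completion (system i)) b I)

record ∞-CompletionEffective
  (𝒞 : SystemClass) (E : CompletionPostEffective 𝒞) : Set₁ where
  open SystemClass 𝒞
  open CompletionPostEffective E
  field
    accelerate  : Rec 3
    accelerate⇓ : ∀ {s i c I} → s codesSystem i → codesIdeal i c I → ∀ b w →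
      Representation.Computes (idealRep i) accelerate
        (s ∷ c ∷ ⌜ map toℕ (b ∷ w) ⌝ ∷ [])
        (IsAcceleration (system i) (b ∷ w) I)

module _ (𝒞 : SystemClass) where
  open SystemClass 𝒞

  CoverDecompositionComputable : CompletionPostEffective 𝒞 → Set₁
  CoverDecompositionComputable E = ∃ λ (f : Rec 2) →
    ∀ {s i c} {x : TransitionSystem.State (system i)} →
    s codesSystem i → codesState i c x →
    Representation.ComputesFiniteSet (CompletionPostEffective.idealRep E i)
      f (s ∷ c ∷ [])
      (let open TransitionSystem (system i) in
       IdealDecomposition states (↓ (Post* x)))

  CoverabilityDecidable : Set
  CoverabilityDecidable = ∃ λ (g : Rec 3) →
    ∀ {s i c d} {x y : TransitionSystem.State (system i)} →
    s codesSystem i → codesState i c x → codesState i d y →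
    Decides g (s ∷ c ∷ d ∷ []) (TransitionSystem.Coverable (system i) x y)

{-# OPTIONS --safe #-}

-- The program computes finite lists L₀ ⊆ L₁ ⊆ … of codes of ideals included in
-- ↓Post*(x): L₀ consists of ↓x, and Lₜ₊₁ adds to Lₜ all its successors and its
-- accelerations along one word. It stops when every ideal of Lₜ₊₁ is included
-- in one of Lₜ. Then ⋃Lₜ is closed under successors, so it is ↓Post*(x), and the
-- ideal decomposition consists of the maximal elements of Lₜ, because an ideal
-- included in a finite union of ideals is included in one of them.
--
-- The program stops because finitely many ideals, obtained from ↓x by successors
-- and accelerations, are closed under successors up to inclusion. This is the
-- Karp–Miller argument: every infinite branch contains I above J with I ⊆ J, and
-- if I ⊂ J, the acceleration of I has a higher level, of which there are
-- finitely many.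

module Submission where

open import Defs
open import Axiom.ExcludedMiddle using (ExcludedMiddle)
open import Data.Empty using (⊥-elim)
open import Data.Fin.Base using (zero; suc; toℕ; fromℕ<; _↑ʳ_)
open import Data.Fin.Patterns using (0F; 1F; 2F; 3F; 4F)
open import Data.Fin.Properties using (toℕ-fromℕ<; fromℕ<-toℕ; toℕ<n; toℕ-injective)
open import Data.List.Base as List
  using (List; []; _∷_; _++_; concat; length; map; replicate; reverseAcc)
open import Data.List.Membership.Propositional using (find; lose) renaming (_∈_ to _∈ᴸ_)
open import Data.List.Membership.Propositional.Properties
  using (∈-concat⁺′; ∈-concat⁻′; ∈-tabulate⁺; ∈-tabulate⁻)
open import Data.List.Properties using (map-injective; ∷-injectiveʳ)
open import Data.List.Relation.Binary.Pointwise using (Pointwise; []; _∷_)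
open import Data.List.Relation.Binary.Subset.Propositional using () renaming (_⊆_ to _⊆ᴸ_)
open import Data.List.Relation.Unary.All as All using (All; []; _∷_)
open import Data.List.Relation.Unary.All.Properties using (¬Any⇒All¬; All¬⇒¬Any)
open import Data.List.Relation.Unary.Any using (Any; here; there)
open import Data.List.Relation.Unary.Any.Properties using (reverseAcc⁺; reverseAcc⁻)
open import Data.Nat.Base
open import Data.Nat.Induction using (<-rec)
open import Data.Nat.Properties
open import Data.Nat.Tactic.RingSolver using (solve-∀)
open import Data.Product.Base using (Σ; ∃; ∃₂; _×_; _,_; proj₁; proj₂)
open import Data.Sum.Base using (_⊎_; inj₁; inj₂; [_,_]′)
open import Data.Vec.Base as Vec using (Vec; []; _∷_)
open import Data.Vec.Properties using (tabulate∘lookup; lookup-++ʳ)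
open import Data.Vec.Relation.Binary.Pointwise.Inductive as VecPointwise using ([]; _∷_)
open import Function.Base using (_∘_; id)
open import Function.Bundles using (mk⇔; Equivalence)
open import Level using (Level; 0ℓ; lift; lower) renaming (suc to lsuc)
open import Relation.Binary.Bundles using (Preorder)
open import Relation.Binary.PropositionalEquality
open import Relation.Nullary using (¬_; Dec; yes; no)
open import Relation.Nullary.Decidable using (map′; decidable-stable)
open import Relation.Unary using (Pred; _∈_; _⊆_; _≐_)

-- Ideals and the completion

-- The Karp-Miller tree is never computed. Its existence is proved classically and serves only to
-- show that the unbounded search for a stable round ends. The accelerations in the tree run along
-- words read off its branches, which the program does not know in advance. It therefore tries every
-- word, one per round, and returns to each word again and again, since an ideal may appear only
-- after the first use of the word that it needs. Accelerations preserve inclusion in ↓Post*(x), so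
-- they may be applied blindly; they matter for reaching a stable round, not for the completeness of
-- one. The assumptions on the completion enter as follows. Determinism makes the successor of an
-- ideal under a letter equal to the whole of ↓Post and leaves one child per letter in the tree.
-- Strict monotonicity keeps chains strict under steps, so that the level of an ideal never drops
-- along a branch and rises at an acceleration of an increasing word.

module _ {a ℓ ℓ′} (T : TransitionSystem a ℓ ℓ′) where
  open TransitionSystem T
  open Preorder states using (module Eq)

  ⟶-respˡ : ∀ {w x x′ y} → x ≈ x′ → x ⟶[ w ] y → x′ ⟶[ w ] y
  ⟶-respˡ x≈x′ (ε x≈y)  = ε (Eq.trans (Eq.sym x≈x′) x≈y)
  ⟶-respˡ x≈x′ (s ∷ r) = proj₂ (step-resp _) x≈x′ s ∷ r

  ⟶-++ : ∀ {u v x y z} → x ⟶[ u ] y → y ⟶[ v ] z → x ⟶[ u ++ v ] z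
  ⟶-++ (ε x≈y) q = ⟶-respˡ (Eq.sym x≈y) q
  ⟶-++ (s ∷ p) q = s ∷ ⟶-++ p q

  ⟶-deterministic : Deterministic → ∀ {w x y z} → x ⟶[ w ] y → x ⟶[ w ] z → y ≈ z
  ⟶-deterministic det (ε x≈y) (ε x≈z) = Eq.trans (Eq.sym x≈y) x≈z
  ⟶-deterministic det (s ∷ p) (t ∷ q) = ⟶-deterministic det p (⟶-respˡ (det t s) q)

  ⟶-strict : StronglyStrictlyMonotone → ∀ {w x y x′} → x ⟶[ w ] y → x ≺ x′ →
             ∃ λ y′ → x′ ⟶[ w ] y′ × y ≺ y′
  ⟶-strict _ (ε x≈y) (x≲x′ , x′≴x) = _ , ε Eq.refl ,
    Preorder.trans states (Preorder.reflexive states (Eq.sym x≈y)) x≲x′ ,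
    λ x′≲y → x′≴x (Preorder.trans states x′≲y (Preorder.reflexive states (Eq.sym x≈y)))
  ⟶-strict mono@(_ , strict) (s ∷ p) x≺x′ with strict s x≺x′
  ... | _ , s′ , y≺y′ with ⟶-strict mono p y≺y′
  ...   | z′ , p′ , z≺z′ = z′ , s′ ∷ p′ , z≺z′

module _ (P : Preorder 0ℓ 0ℓ 0ℓ) where
  open Preorder P

  chain-mono : ∀ (f : ℕ → Ideal P) → (∀ k → members (f k) ⊆ members (f (suc k))) →
               ∀ {j k} → j ≤′ k → members (f j) ⊆ members (f k)
  chain-mono f inc ≤′-refl       x∈ = x∈
  chain-mono f inc (≤′-step j≤k) x∈ = inc _ (chain-mono f inc j≤k x∈)

  ⋃-ideal : (f : ℕ → Ideal P) → (∀ k → members (f k) ⊆ members (f (suc k))) → Ideal P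
  ⋃-ideal f inc = record
    { members    = λ x → ∃ λ k → x ∈ members (f k)
    ; inhabited  = let x , x∈ = inhabited (f 0) in x , 0 , x∈
    ; downClosed = λ { x≲y (k , y∈) → k , downClosed (f k) x≲y y∈ }
    ; directed   = λ { (j , x∈) (k , y∈) →
        let z , z∈ , x≲z , y≲z = directed (f (j ⊔ k))
              (chain-mono f inc (≤⇒≤′ (m≤m⊔n j k)) x∈)
              (chain-mono f inc (≤⇒≤′ (m≤n⊔m j k)) y∈)
        in z , (j ⊔ k , z∈) , x≲z , y≲z }
    }

  IdlLevel-resp : ∀ n {I J} → members I ≐ members J → I ∈ IdlLevel P n → J ∈ IdlLevel P n
  IdlLevel-resp zero    _           _ = _
  IdlLevel-resp (suc n) (I⊆J , J⊆I) (f , lvl , inc , I⊆ , ⊆I) =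
    f , lvl , inc , (λ x∈ → I⊆ (J⊆I x∈)) , (λ x∈ → I⊆J (⊆I x∈))

module Theory (lem : ExcludedMiddle (lsuc 0ℓ)) (S : System) (very : IsVeryWSTS S) where

  open TransitionSystem S
  private module C = TransitionSystem (completion S)
  open C using () renaming (_⟶[_]_ to _⟹[_]_; _≺_ to _⊊_; _≲_ to _⊑_; step to _⇒_)
  open Preorder states using (module Eq)
    renaming (refl to ≲-refl; trans to ≲-trans; reflexive to ≲-reflexive)

  lem₀ : {P : Set} → Dec P
  lem₀ = map′ lower lift lem

  stable : {P : Set₁} → ¬ ¬ P → P
  stable = decidable-stable lem

  stable₀ : {P : Set} → ¬ ¬ P → P
  stable₀ = decidable-stable lem₀

  private
    strong : StronglyMonotone
    strong = proj₁ (proj₂ very)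

    wqo : C.WellQuasiOrdered
    wqo = proj₁ (proj₁ (proj₂ (proj₂ very)))

    C-deterministic : C.Deterministic
    C-deterministic {b} {I} {J} {K} = proj₁ (proj₂ (proj₂ (proj₂ very))) {b} {I} {J} {K}

    deterministic : ∀ {b} I {J K} → (b ⇒ I) J → (b ⇒ I) K → members J ≐ members K
    deterministic I {J} {K} = C-deterministic {x = I} {J} {K}

    strict : C.StronglyStrictlyMonotone
    strict = proj₁ (proj₂ (proj₂ (proj₂ (proj₂ very))))

    height : ℕ
    height = proj₁ (proj₂ (proj₂ (proj₂ (proj₂ (proj₂ very)))))

    top-empty : ∀ I → ¬ I ∈ IdlLevel states height
    top-empty = proj₂ (proj₂ (proj₂ (proj₂ (proj₂ (proj₂ very)))))

  Level∋ : ℕ → StateIdeal S → Set₁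
  Level∋ n I = I ∈ IdlLevel states n

  ↓-closed : ∀ {p} {D : Pred State p} {x y} → x ≲ y → y ∈ ↓ D → x ∈ ↓ D
  ↓-closed x≲y (z , z∈D , y≲z) = z , z∈D , ≲-trans x≲y y≲z

  -- If no ideal of D above I were maximal, iterating strict enlargements would
  -- produce ideals of every level.
  maximal-above : ∀ {D : Pred State 0ℓ} I → members I ⊆ D →
                  ∃ λ J → I ⊑ J × J ∈ IdealDecomposition states D
  maximal-above {D} I I⊆D = stable λ none →
    let L , lvl , _ = climb none height (I , I⊆D , id) in top-empty L lvl
    where
    Above : Set₁
    Above = ∃ λ K → members K ⊆ D × I ⊑ K

    None : Set₁
    None = ¬ ∃ λ J → I ⊑ J × J ∈ IdealDecomposition states D

    grow : None → ∀ (K : Above) → ∃ λ (L : Above) → proj₁ K ⊊ proj₁ L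
    grow none (K , K⊆D , I⊆K) = stable {∃ λ (L : Above) → K ⊊ proj₁ L} λ stuck →
      none (K , I⊆K , K⊆D , λ L L⊆D K⊆L {x} x∈L →
        stable₀ λ x∉K → stuck ((L , L⊆D , λ x∈ → K⊆L (I⊆K x∈)) , K⊆L , λ L⊆K → x∉K (L⊆K x∈L)))

    climb : None → ∀ n (K : Above) → ∃ λ L → Level∋ n L × proj₁ K ⊑ L × members L ⊆ D
    climb none zero    (K , K⊆D , _) = K , _ , id , K⊆D
    climb none (suc n) K₀ =
      ⋃-ideal states f (λ k → proj₁ (f⊊ k)) ,
      (f , (λ k → proj₁ (proj₂ (seq k))) , f⊊ , id , id) ,
      (λ x∈ → 0 , proj₁ (proj₂ (proj₂ (climb none n K₀))) x∈) ,
      λ { (k , x∈) → proj₂ (proj₂ (seq k)) x∈ }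
      where
      Stage : Set₁
      Stage = ∃ λ L → Level∋ n L × (I ⊑ L) × (members L ⊆ D)

      restage : (K : Above) → ∃ λ (L : Stage) → proj₁ K ⊑ proj₁ L
      restage (K , K⊆D , I⊆K) =
        let L , lvl , K⊆L , L⊆D = climb none n (K , K⊆D , I⊆K)
        in (L , lvl , (λ x∈ → K⊆L (I⊆K x∈)) , L⊆D) , K⊆L

      next : (L : Stage) → ∃ λ (M : Stage) → proj₁ L ⊊ proj₁ M
      next (L , _ , I⊆L , L⊆D) =
        let K , L⊆K , K⊈L = grow none (L , L⊆D , I⊆L)
            M , K⊆M       = restage K
        in M , (λ x∈ → K⊆M (L⊆K x∈)) , λ M⊆L → K⊈L (λ x∈ → M⊆L (K⊆M x∈))

      stage : ℕ → Stage
      stage zero    = proj₁ (restage K₀)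
      stage (suc k) = proj₁ (next (stage k))

      seq : ℕ → ∃ λ L → Level∋ n L × members L ⊆ D
      seq k = let L , lvl , _ , L⊆D = stage k in L , lvl , L⊆D

      f : ℕ → StateIdeal S
      f k = proj₁ (seq k)

      f⊊ : ∀ k → f k ⊊ f (suc k)
      f⊊ k = proj₂ (next (stage k))

  -- The principal ideal of `z` is included in the downward-closed set, and a maximal ideal above it
  -- contains `z`. Thus the decomposition covers the whole set.
  successor-at : ∀ {b I z} → z ∈ ↓ (Post (members I) b) →
                 ∃ λ J → (b ⇒ I) J × z ∈ members J
  successor-at {b} {I} {z} z∈ =
    let J , z⊆J , max = maximal-above {↓ (Post (members I) b)} (principal states z)
                          (λ y≲z → ↓-closed y≲z z∈)
    in J , max , z⊆J ≲-refl

  -- Each point lies in some successor of `I`, and by determinism that successor equals `J`.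
  successor-full : ∀ {b} I {J} → (b ⇒ I) J → ↓ (Post (members I) b) ⊆ members J
  successor-full {b} I {J} I⇒J z∈ =
    let K , I⇒K , z∈K = successor-at {b} {I} z∈ in proj₁ (deterministic I {K} {J} I⇒K I⇒J) z∈K

  -- The successor of a union of a chain is the union of the successors, and strict monotonicity
  -- keeps that chain strict. Early members of the chain may have no successor, so it is started at
  -- an index `k₀` where some state of `f k₀` can fire `b`.
  Level-post : ∀ n {b I J} → (b ⇒ I) J → Level∋ n I → Level∋ n J
  Level-post zero    _ _ = _
  Level-post (suc n) {b} {I} {J} I⇒J (f , lvl , inc , I⊆ , ⊆I) with inhabited J
  ... | z , z∈J with proj₁ I⇒J z∈J
  ...   | y , (x , x∈I , x→y) , z≲y with I⊆ x∈I
  ...     | k₀ , x∈f = g , g-lvl , (λ k → proj₂ (proj₂ (next (img k)))) , J⊆⋃g , ⋃g⊆J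
    where
    Image : ℕ → Set₁
    Image k = ∃ λ K → (b ⇒ f (k + k₀)) K

    next : ∀ {k} ((K , _) : Image k) → ∃ λ L → (b ⇒ f (suc k + k₀)) L × K ⊊ L
    next {k} (K , f⇒K) = proj₂ strict {x = f (k + k₀)} {K} {f (suc k + k₀)} f⇒K (inc (k + k₀))

    img : ∀ k → Image k
    img zero    = let K , f⇒K , _ = successor-at {b} {f k₀} (y , (x , x∈f , x→y) , z≲y) in K , f⇒K
    img (suc k) = let L , f⇒L , _ = next (img k) in L , f⇒L

    g : ℕ → StateIdeal S
    g k = proj₁ (img k)

    g-lvl : ∀ k → Level∋ n (g k)
    g-lvl k = Level-post n (proj₂ (img k)) (lvl (k + k₀))

    J⊆⋃g : ∀ {u} → u ∈ members J → ∃ λ k → u ∈ members (g k)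
    J⊆⋃g u∈J with proj₁ I⇒J u∈J
    ... | v , (t , t∈I , t→v) , u≲v with I⊆ t∈I
    ...   | k , t∈f = k , successor-full (f (k + k₀)) {g k} (proj₂ (img k))
      (v , (t , chain-mono states f (λ k → proj₁ (inc k)) (≤⇒≤′ (m≤m+n k k₀)) t∈f , t→v) , u≲v)

    ⋃g⊆J : ∀ {u} → (∃ λ k → u ∈ members (g k)) → u ∈ members J
    ⋃g⊆J (k , u∈g) with proj₁ (proj₂ (img k)) u∈g
    ... | v , (t , t∈f , t→v) , u≲v =
      successor-full I {J} I⇒J (v , (t , ⊆I (k + k₀ , t∈f) , t→v) , u≲v)

  Level-word : ∀ n {w I J} → I ⟹[ w ] J → Level∋ n I → Level∋ n J
  Level-word n (ε I≈J) lvl = IdlLevel-resp states n I≈J lvl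
  Level-word n (s ∷ r) lvl = Level-word n r (Level-post n s lvl)

  -- Strict monotonicity propagates the first strict inclusion to all iterates, so their union is
  -- the limit of a strict chain of ideals of level `n`. Determinism identifies this chain with the
  -- iterates in the definition of `IsAcceleration`.
  acceleration : ∀ n {w I} → Increases S w I → Level∋ n I →
    ∃ λ K → IsAcceleration S w I K × Level∋ (suc n) K × I ⊑ K
  acceleration n {w} {I} incr@(J , I⟹J , I⊊J) lvl =
    K , inj₁ (incr , K⊆ , ⊆K) ,
    (f s₀ , (λ k → Level-word n (reach s₀ k) lvl) , f⊊ s₀ , id , id) , λ x∈ → 0 , x∈
    where
    Step : Set₁
    Step = ∃₂ λ A B → A ⟹[ w ] B × A ⊊ B

    s₀ : Step
    s₀ = I , J , I⟹J , I⊊J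

    next : Step → Step
    next (A , B , A⟹B , A⊊B) = B , ⟶-strict (completion S) strict A⟹B A⊊B

    f : Step → ℕ → StateIdeal S
    f s zero    = proj₁ s
    f s (suc k) = f (next s) k

    f⊊ : ∀ s k → f s k ⊊ f s (suc k)
    f⊊ (_ , _ , _ , A⊊B) zero    = A⊊B
    f⊊ s                 (suc k) = f⊊ (next s) k

    reach : ∀ s k → proj₁ s ⟹[ concat (replicate k w) ] f s k
    reach s                   zero    = C.ε (id , id)
    reach s@(A , B , A⟹B , _) (suc k) = ⟶-++ (completion S) A⟹B (reach (next s) k)

    K : StateIdeal S
    K = ⋃-ideal states (f s₀) (λ k → proj₁ (f⊊ s₀ k))

    K⊆ : ∀ {x} → x ∈ members K → x ∈ ⋃-iterates S w I
    K⊆ (k , x∈) = k , f s₀ k , reach s₀ k , x∈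

    ⊆K : ∀ {x} → x ∈ ⋃-iterates S w I → x ∈ members K
    ⊆K (k , L , I⟹L , x∈) = k , proj₁ L≐ x∈
      where
      L≐ : members L ≐ members (f s₀ k)
      L≐ = ⟶-deterministic (completion S)
        (λ {b} {I} {J} {K} → C-deterministic {b} {I} {J} {K}) I⟹L (reach s₀ k)

  -- Links the ideal output by the program `accelerate` with the one that the tree argument
  -- constructs by hand.
  acceleration-unique : ∀ {w I K L} → IsAcceleration S w I K → IsAcceleration S w I L →
                        members K ≐ members L
  acceleration-unique (inj₁ (_ , a , b)) (inj₁ (_ , c , d)) = (λ x → d (a x)) , (λ x → b (c x))
  acceleration-unique (inj₁ (i , _)) (inj₂ (¬i , _)) = ⊥-elim (¬i i)
  acceleration-unique (inj₂ (¬i , _)) (inj₁ (i , _)) = ⊥-elim (¬i i)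
  acceleration-unique (inj₂ (_ , a , b)) (inj₂ (_ , c , d)) = (λ x → d (a x)) , (λ x → b (c x))

  acceleration-resp : ∀ {w} I J K → members I ≐ members J →
                      IsAcceleration S w I K → IsAcceleration S w J K
  acceleration-resp I J K I≐J@(I⊆J , J⊆I) (inj₁ ((L , I⟹L , I⊆L , L⊈I) , K⊆ , ⊆K)) = inj₁
    ( (L , ⟶-respˡ (completion S) I≐J I⟹L , (λ x∈ → I⊆L (J⊆I x∈)) , λ L⊆J → L⊈I λ x∈ → J⊆I (L⊆J x∈))
    , (λ x∈ → let k , M , I⟹M , x∈M = K⊆ x∈ in k , M , ⟶-respˡ (completion S) I≐J I⟹M , x∈M)
    , λ (k , M , J⟹M , x∈M) → ⊆K (k , M , ⟶-respˡ (completion S) (J⊆I , I⊆J) J⟹M , x∈M) )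
  acceleration-resp I J K I≐J@(I⊆J , J⊆I) (inj₂ (¬incr , K⊆I , I⊆K)) = inj₂
    ( (λ (L , J⟹L , J⊆L , L⊈J) → ¬incr
        ( L , ⟶-respˡ (completion S) (J⊆I , I⊆J) J⟹L
        , (λ x∈ → J⊆L (I⊆J x∈)) , λ L⊆I → L⊈J λ x∈ → I⊆J (L⊆I x∈) ))
    , (λ x∈ → I⊆J (K⊆I x∈)) , λ x∈ → I⊆K (J⊆I x∈) )

  -- Soundness and completeness of sets of ideals with respect to ↓Post*(x)

  Sound : State → StateIdeal S → Set
  Sound x I = members I ⊆ ↓ (Post* x)

  principal-sound : ∀ x → Sound x (principal states x)
  principal-sound x z≲x = x , ([] , ε Eq.refl) , z≲x

  -- A state of `I` need not be reachable itself, only below a reachable `u`; strong monotonicity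
  -- lets `u` imitate the step.
  post-sound : ∀ {x b} I J → (b ⇒ I) J → Sound x I → Sound x J
  post-sound I J I⇒J I-sound z∈J with proj₁ I⇒J z∈J
  ... | y′ , (y , y∈I , y→y′) , z≲y′ with I-sound y∈I
  ...   | u , (w , x⟶u) , y≲u with strong y→y′ y≲u
  ...     | u′ , u→u′ , y′≲u′ =
    u′ , (_ , ⟶-++ S x⟶u (u→u′ ∷ ε Eq.refl)) , ≲-trans z≲y′ y′≲u′

  word-sound : ∀ {x w I J} → I ⟹[ w ] J → Sound x I → Sound x J
  word-sound (ε (_ , J⊆I)) I-sound = λ z∈J → I-sound (J⊆I z∈J)
  word-sound {I = I} (_∷_ {y = J} s r) I-sound = word-sound r (post-sound I J s I-sound)

  acceleration-sound : ∀ {x w I K} → IsAcceleration S w I K → Sound x I → Sound x K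
  acceleration-sound (inj₁ (_ , K⊆ , _)) I-sound z∈K =
    let _ , _ , I⟹J , z∈J = K⊆ z∈K in word-sound I⟹J I-sound z∈J
  acceleration-sound (inj₂ (_ , K⊆I , _)) I-sound z∈K = I-sound (K⊆I z∈K)

  Closed : ∀ {p} → Pred (StateIdeal S) p → Set _
  Closed G = ∀ {b} I {J} → I ∈ G → (b ⇒ I) J → ∃ λ K → K ∈ G × J ⊑ K

  -- A run from `x` is followed letter by letter: some successor of the current ideal contains the
  -- next state, and closedness replaces it by a larger ideal of `G`.
  closed-covers : ∀ {p} {G : Pred (StateIdeal S) p} → Closed G → ∀ {x I} → I ∈ G → x ∈ members I →
                  ∀ {z} → z ∈ ↓ (Post* x) → ∃ λ K → K ∈ G × z ∈ members K
  closed-covers {G = G} closed I∈G x∈I (y , (w , x⟶y) , z≲y) =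
    let K , K∈G , y∈K = go I∈G x∈I x⟶y in K , K∈G , downClosed K z≲y y∈K
    where
    go : ∀ {I x w y} → I ∈ G → x ∈ members I → x ⟶[ w ] y → ∃ λ K → K ∈ G × y ∈ members K
    go {I} I∈G x∈I (ε x≈y) = I , I∈G , downClosed I (≲-reflexive (Eq.sym x≈y)) x∈I
    go {I} {x} I∈G x∈I (_∷_ {b = b} {y = y} x→y r) =
      let J , I⇒J , y∈J = successor-at {b} {I} (y , (x , x∈I , x→y) , ≲-refl)
          K , K∈G , J⊆K = closed I {J} I∈G I⇒J
      in go K∈G (J⊆K y∈J) r

  -- If `K` escapes every `J` of the list, directedness yields an upper bound in `K` of the finitely
  -- many escaping states, and it lies in no `J` because each `J` is downward closed.
  ideal-prime : ∀ K (Js : List (StateIdeal S)) →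
                (∀ {z} → z ∈ members K → Any (λ J → z ∈ members J) Js) → Any (K ⊑_) Js
  ideal-prime K Js K⊆⋃ = stable λ none →
    let z , z∈K , z∉ = outside (¬Any⇒All¬ Js none) in All¬⇒¬Any z∉ (K⊆⋃ z∈K)
    where
    outside : ∀ {Js} → All (λ J → ¬ K ⊑ J) Js →
              ∃ λ z → z ∈ members K × All (λ J → ¬ z ∈ members J) Js
    outside [] = let z , z∈K = inhabited K in z , z∈K , []
    outside {J ∷ _} (K⋢J ∷ none) =
      let z , z∈K , z∉ = outside none
          y , y∈K , y∉J = stable₀ λ all → K⋢J λ {x} x∈K → stable₀ λ x∉J → all (x , x∈K , x∉J)
          u , u∈K , z≲u , y≲u = directed K z∈K y∈K
      in u , u∈K , (λ u∈J → y∉J (downClosed J y≲u u∈J)) ∷ up z≲u z∉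
      where
      up : ∀ {z u Js} → z ≲ u → All (λ J → ¬ z ∈ members J) Js → All (λ J → ¬ u ∈ members J) Js
      up z≲u []         = []
      up {Js = J ∷ _} z≲u (z∉ ∷ zs) = (λ u∈ → z∉ (downClosed J z≲u u∈)) ∷ up z≲u zs

  -- Finiteness of the Karp-Miller tree

  data Reachable (I : StateIdeal S) : StateIdeal S → Set₁ where
    start : Reachable I I
    fire  : ∀ {b J K} → Reachable I J → (b ⇒ J) K → Reachable I K
    jump  : ∀ {b w J K} → Reachable I J → IsAcceleration S (b ∷ w) J K → Reachable I K

  Reachable-trans : ∀ {I J K} → Reachable I J → Reachable J K → Reachable I K
  Reachable-trans p start      = p
  Reachable-trans p (fire q s) = fire (Reachable-trans p q) s
  Reachable-trans p (jump q a) = jump (Reachable-trans p q) a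

  _▷_ : List (StateIdeal S) → List (StateIdeal S) → StateIdeal S → Set₁
  (F ▷ H) I = ∃ λ K → (K ∈ᴸ F ⊎ K ∈ᴸ H) × I ⊑ K

  -- The Karp–Miller tree below I can be cut off at ideals included in one of
  -- the ancestors H.
  record Terminates (H : List (StateIdeal S)) (I : StateIdeal S) : Set₁ where
    field
      family    : List (StateIdeal S)
      reachable : ∀ {J} → J ∈ᴸ family → Reachable I J
      root      : (family ▷ H) I
      closed    : ∀ {b} J {K} → J ∈ᴸ family → (b ⇒ J) K → (family ▷ H) K

  open Terminates

  -- By determinism one child per letter represents all successors, so the family is a finite union
  -- over the alphabet. What a child cuts off at `I` is now covered by `I` as a member of the
  -- family.
  node : ∀ {H I} → (∀ b J → (b ⇒ I) J → Terminates (I ∷ H) J) → Terminates H I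
  node {H} {I} children = record
    { family    = family′
    ; reachable = reach
    ; root      = I , inj₁ (here refl) , id
    ; closed    = λ {b} J {K} → close {b} J {K}
    }
    where
    Branch : Letter → Set₁
    Branch b = Σ (List (StateIdeal S)) λ F →
      (∀ {J} → J ∈ᴸ F → Reachable I J) ×
      (∀ {J} → (b ⇒ I) J → (F ▷ (I ∷ H)) J) ×
      (∀ {c} J {K} → J ∈ᴸ F → (c ⇒ J) K → (F ▷ (I ∷ H)) K)

    branch : ∀ b → Branch b
    branch b with lem {∃ (b ⇒ I)}
    ... | no dead = [] , (λ ()) , (λ {J} I⇒J → ⊥-elim (dead (J , I⇒J))) , λ _ ()
    ... | yes (J , I⇒J) = let t = children b J I⇒J in
      family t , (λ K∈ → Reachable-trans (fire start I⇒J) (reachable t K∈)) ,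
      (λ {K} I⇒K → let L , L∈ , J⊆L = root t in
        L , L∈ , λ x∈ → J⊆L (proj₁ (deterministic I {K} {J} I⇒K I⇒J) x∈)) ,
      λ {c} K {L} → closed t {c} K {L}

    family′ : List (StateIdeal S)
    family′ = I ∷ concat (List.tabulate (λ b → proj₁ (branch b)))

    embed : ∀ {b J} → J ∈ᴸ proj₁ (branch b) → J ∈ᴸ family′
    embed {b} J∈ = there (∈-concat⁺′ J∈ (∈-tabulate⁺ b))

    lift-▷ : ∀ {b J} → (proj₁ (branch b) ▷ (I ∷ H)) J → (family′ ▷ H) J
    lift-▷ (K , inj₁ K∈ , J⊆K)         = K , inj₁ (embed K∈) , J⊆K
    lift-▷ (K , inj₂ (here refl) , J⊆K) = K , inj₁ (here refl) , J⊆K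
    lift-▷ (K , inj₂ (there K∈) , J⊆K)  = K , inj₂ K∈ , J⊆K

    locate : ∀ {J} → J ∈ᴸ concat (List.tabulate (λ b → proj₁ (branch b))) →
             ∃ λ b → J ∈ᴸ proj₁ (branch b)
    locate J∈ with ∈-concat⁻′ (List.tabulate (λ b → proj₁ (branch b))) J∈
    ... | F , J∈F , F∈ with ∈-tabulate⁻ {f = λ b → proj₁ (branch b)} F∈
    ...   | b , refl = b , J∈F

    reach : ∀ {J} → J ∈ᴸ family′ → Reachable I J
    reach (here refl) = start
    reach (there J∈)  = let b , J∈F = locate J∈ in proj₁ (proj₂ (branch b)) J∈F

    close : ∀ {b} J {K} → J ∈ᴸ family′ → (b ⇒ J) K → (family′ ▷ H) K
    close {b} _ {K} (here refl) s = lift-▷ {b} {K} (proj₁ (proj₂ (proj₂ (branch b))) {K} s)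
    close {b} J {K} (there J∈) s = let c , J∈F = locate J∈ in
      lift-▷ {c} {K} (proj₂ (proj₂ (proj₂ (branch c))) {b} J {K} J∈F s)

  -- Were the tree infinite, some branch would be; on it the wqo yields I ⊆ J
  -- with I above J. Equality means that J is cut off; otherwise the
  -- acceleration of I, which lies one level higher, covers I.
  level-terminates : ∀ m {n} → m + n ≡ height → ∀ I → Level∋ n I → Terminates [] I
  level-terminates zero    refl I lvl = ⊥-elim (top-empty I lvl)
  level-terminates (suc m) {n} eq I lvl = stable λ ¬t → no-bad ([] , I , lvl , ¬t)
    where
    Bad : Set₁
    Bad = Σ (List (StateIdeal S)) λ H → ∃ λ J → Level∋ n J × ¬ Terminates H J

    history : Bad → List (StateIdeal S)
    history = proj₁

    ideal : Bad → StateIdeal S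
    ideal s = proj₁ (proj₂ s)

    next : (s : Bad) → Σ Bad λ t → history t ≡ ideal s ∷ history s × ∃ λ b → (b ⇒ ideal s) (ideal t)
    next (H , J , lvl , ¬t) with lem {∃₂ λ b K → (b ⇒ J) K × ¬ Terminates (J ∷ H) K}
    ... | yes (b , K , J⇒K , ¬tK) = (J ∷ H , K , Level-post n J⇒K lvl , ¬tK) , refl , b , J⇒K
    -- If every child terminated, `node` would assemble them. So badness passes to some child, and
    -- an infinite branch arises without a separate appeal to König's lemma.
    ... | no none = ⊥-elim (¬t (node λ b K J⇒K → stable λ ¬tK → none (b , K , J⇒K , ¬tK)))

    run : Bad → ℕ → Bad
    run s zero    = s
    run s (suc k) = run (proj₁ (next s)) k

    run-+ : ∀ s j k → run s (j + k) ≡ run (run s j) k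
    run-+ s zero    k = refl
    run-+ s (suc j) k = run-+ (proj₁ (next s)) j k

    history-run : ∀ s k {J} → J ∈ᴸ history s → J ∈ᴸ history (run s k)
    history-run s zero    J∈ = J∈
    history-run s (suc k) J∈ = history-run (proj₁ (next s)) k
      (subst (_ ∈ᴸ_) (sym (proj₁ (proj₂ (next s)))) (there J∈))

    word-run : ∀ s k → ∃ λ w → ideal s ⟹[ w ] ideal (run s k)
    word-run s zero    = [] , C.ε (id , id)
    word-run s (suc k) = let _ , _ , _ , J⇒K = next s
                             w , r = word-run (proj₁ (next s)) k
                         in _ , J⇒K C.∷ r

    no-repeat : ∀ s k → ¬ ideal s ⊑ ideal (run s (suc k))
    no-repeat s k J⊆K with lem₀ {ideal (run s (suc k)) ⊑ ideal s}
    ... | yes K⊆J = proj₂ (proj₂ (proj₂ (run s (suc k)))) record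
      { family    = []
      ; reachable = λ ()
      ; root      = ideal s , inj₂ (history-run (proj₁ (next s)) k
          (subst (ideal s ∈ᴸ_) (sym (proj₁ (proj₂ (next s)))) (here refl))) , K⊆J
      ; closed    = λ _ ()
      }
    ... | no K⊈J = proj₂ (proj₂ (proj₂ s)) record
      { family    = family t
      ; reachable = λ L∈ → Reachable-trans (jump start isAcc) (reachable t L∈)
      ; root      = let L , L∈ , K⊆L = root t in
          weaken {J = ideal s} (L , L∈ , λ x∈ → K⊆L (J⊆acc x∈))
      ; closed    = λ {b} L {M} L∈ s → weaken {J = M} (closed t {b} L {M} L∈ s)
      }
      where
      b = proj₁ (proj₂ (proj₂ (next s)))
      w = proj₁ (word-run (proj₁ (next s)) k)
      accelerated = acceleration n {b ∷ w} {ideal s}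
        (ideal (run s (suc k)) ,
         proj₂ (proj₂ (proj₂ (next s))) C.∷ proj₂ (word-run (proj₁ (next s)) k) , J⊆K , K⊈J)
        (proj₁ (proj₂ (proj₂ s)))
      isAcc = proj₁ (proj₂ accelerated)
      J⊆acc = proj₂ (proj₂ (proj₂ accelerated))
      t : Terminates [] (proj₁ accelerated)
      t = level-terminates m (trans (+-suc m n) eq)
            (proj₁ accelerated) (proj₁ (proj₂ (proj₂ accelerated)))
      weaken : ∀ {F H J} → (F ▷ []) J → (F ▷ H) J
      weaken (M , inj₁ M∈ , L⊆M) = M , inj₁ M∈ , L⊆M

    no-bad : ¬ Bad
    no-bad s with wqo (λ k → ideal (run s k))
    -- The branch is restarted at position `i`, and `j` is `i + suc (j ∸ suc i)`.
    ... | i , j , i<j , J⊆K = no-repeat (run s i) (j ∸ suc i)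
      (subst (λ t → ideal (run s i) ⊑ ideal t)
        (trans (cong (run s) (sym (trans (+-suc i _) (m+[n∸m]≡n i<j))))
               (run-+ s i (suc (j ∸ suc i)))) J⊆K)

  terminates : ∀ I → Terminates [] I
  terminates I = level-terminates height (+-identityʳ height) I _

-- Partial recursive functions on coded lists

private
  variable
    ℓ : Level
    m n k : ℕ

-- Weakening: passes the parameters on to a subprogram after `k` local arguments.
projs : ∀ k → Vec (Rec (k + n)) n
projs k = Vec.tabulate (λ i → proj (k ↑ʳ i))

projs⇓ : (ys : Vec ℕ k) (xs : Vec ℕ n) →
         VecPointwise.Pointwise (λ g y → g [ ys Vec.++ xs ]⇓ y) (projs k) xs
projs⇓ {k = k} ys xs =
  subst (VecPointwise.Pointwise _ (projs k)) (tabulate∘lookup xs)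
    (VecPointwise.tabulate⁺ (λ i →
      subst (proj (k ↑ʳ i) [ ys Vec.++ xs ]⇓_) (lookup-++ʳ ys xs i) proj⇓))

constᴿ : ℕ → Rec n
constᴿ zero    = zero
constᴿ (suc k) = comp succ (constᴿ k ∷ [])

constᴿ⇓ : ∀ k {xs : Vec ℕ n} → constᴿ k [ xs ]⇓ k
constᴿ⇓ zero    = zero⇓
constᴿ⇓ (suc k) = comp⇓ (constᴿ⇓ k ∷ []) succ⇓

-- Arithmetic, Boolean connectives and bounded use of minimisation

addᴿ mulᴿ : Rec 2
addᴿ = prec (proj 0F) (comp succ (proj 1F ∷ []))
mulᴿ = prec zero (comp addᴿ (proj 2F ∷ proj 1F ∷ []))

addᴿ⇓ : ∀ m {n} → addᴿ [ m ∷ n ∷ [] ]⇓ m + n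
addᴿ⇓ zero    = prec⇓₀ proj⇓
addᴿ⇓ (suc m) = prec⇓₁ (addᴿ⇓ m) (comp⇓ (proj⇓ ∷ []) succ⇓)

mulᴿ⇓ : ∀ m {n} → mulᴿ [ m ∷ n ∷ [] ]⇓ m * n
mulᴿ⇓ zero        = prec⇓₀ zero⇓
mulᴿ⇓ (suc m) {n} = prec⇓₁ (mulᴿ⇓ m) (comp⇓ (proj⇓ ∷ proj⇓ ∷ []) (addᴿ⇓ n))

isZeroᴿ predᴿ : Rec 1
isZeroᴿ = prec (constᴿ 1) zero
predᴿ   = prec zero (proj 0F)

isZeroᴿ⇓₀ : isZeroᴿ [ 0 ∷ [] ]⇓ 1
isZeroᴿ⇓₀ = prec⇓₀ (constᴿ⇓ 1)

isZeroᴿ⇓₊ : ∀ m → isZeroᴿ [ suc m ∷ [] ]⇓ 0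
isZeroᴿ⇓₊ zero    = prec⇓₁ isZeroᴿ⇓₀ zero⇓
isZeroᴿ⇓₊ (suc m) = prec⇓₁ (isZeroᴿ⇓₊ m) zero⇓

predᴿ⇓ : ∀ m → predᴿ [ m ∷ [] ]⇓ pred m
predᴿ⇓ zero    = prec⇓₀ zero⇓
predᴿ⇓ (suc m) = prec⇓₁ (predᴿ⇓ m) proj⇓

-- The arguments are swapped: the recursion is on the number subtracted.
monusᴿ : Rec 2
monusᴿ = prec (proj 0F) (comp predᴿ (proj 1F ∷ []))

monusᴿ⇓ : ∀ n {m} → monusᴿ [ n ∷ m ∷ [] ]⇓ m ∸ n
monusᴿ⇓ zero        = prec⇓₀ proj⇓
monusᴿ⇓ (suc n) {m} = prec⇓₁ (monusᴿ⇓ n) (comp⇓ (proj⇓ ∷ [])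
  (subst (predᴿ [ m ∸ n ∷ [] ]⇓_) (pred[m∸n]≡m∸[1+n] m n) (predᴿ⇓ (m ∸ n))))

-- Recursion on the truth value evaluates the base case `h` first, so `h` must converge in both
-- cases, whereas `g` runs only when the test gives 1. Programs specified on special inputs only,
-- such as `accelerate`, therefore belong in the place of `g`.
ifᴿ : Rec n → Rec n → Rec n → Rec n
ifᴿ f g h = comp (prec h (comp g (projs 2))) (f ∷ projs 0)

ifᴿ⇓₁ : ∀ {f g h : Rec n} {xs y z} →
        f [ xs ]⇓ 1 → g [ xs ]⇓ y → h [ xs ]⇓ z → ifᴿ f g h [ xs ]⇓ y
ifᴿ⇓₁ {xs = xs} {z = z} f⇓ g⇓ h⇓ = comp⇓ (f⇓ ∷ projs⇓ [] xs)
  (prec⇓₁ (prec⇓₀ h⇓) (comp⇓ (projs⇓ (0 ∷ z ∷ []) xs) g⇓))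

ifᴿ⇓₀ : ∀ {f g h : Rec n} {xs z} →
        f [ xs ]⇓ 0 → h [ xs ]⇓ z → ifᴿ f g h [ xs ]⇓ z
ifᴿ⇓₀ {xs = xs} f⇓ h⇓ = comp⇓ (f⇓ ∷ projs⇓ [] xs) (prec⇓₀ h⇓)

notᴿ : Rec n → Rec n
notᴿ f = comp isZeroᴿ (f ∷ [])

orᴿ andᴿ : Rec n → Rec n → Rec n
orᴿ f g  = notᴿ (notᴿ (comp addᴿ (f ∷ g ∷ [])))
andᴿ f g = notᴿ (orᴿ (notᴿ f) (notᴿ g))

private
  variable
    P Q : Set ℓ
    f g : Rec n
    xs  : Vec ℕ n

notᴿ-decides : Decides f xs P → Decides (notᴿ f) xs (¬ P)
notᴿ-decides (inj₁ (p , f⇓))  = inj₂ ((λ ¬p → ¬p p) , comp⇓ (f⇓ ∷ []) (isZeroᴿ⇓₊ 0))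
notᴿ-decides (inj₂ (¬p , f⇓)) = inj₁ (¬p , comp⇓ (f⇓ ∷ []) isZeroᴿ⇓₀)

Decides-cong : (P → Q) → (Q → P) → Decides f xs P → Decides f xs Q
Decides-cong to from (inj₁ (p , f⇓))  = inj₁ (to p , f⇓)
Decides-cong to from (inj₂ (¬p , f⇓)) = inj₂ (¬p ∘ from , f⇓)

Decides⇒Dec : Decides f xs P → Dec P
Decides⇒Dec (inj₁ (p , _))  = yes p
Decides⇒Dec (inj₂ (¬p , _)) = no ¬p

Decides⇒⇓ : Decides f xs P → ∃ λ y → f [ xs ]⇓ y
Decides⇒⇓ (inj₁ (_ , f⇓)) = 1 , f⇓
Decides⇒⇓ (inj₂ (_ , f⇓)) = 0 , f⇓

signᴿ-decides : ∀ {v} → f [ xs ]⇓ v → Decides (notᴿ (notᴿ f)) xs (v ≢ 0)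
signᴿ-decides {v = zero}  f⇓ =
  inj₂ ((λ 0≢0 → 0≢0 refl) , comp⇓ (comp⇓ (f⇓ ∷ []) isZeroᴿ⇓₀ ∷ []) (isZeroᴿ⇓₊ 0))
signᴿ-decides {v = suc v} f⇓ =
  inj₁ ((λ ()) , comp⇓ (comp⇓ (f⇓ ∷ []) (isZeroᴿ⇓₊ v) ∷ []) isZeroᴿ⇓₀)

orᴿ-decides : Decides f xs P → Decides g xs Q → Decides (orᴿ f g) xs (P ⊎ Q)
orᴿ-decides (inj₁ (p , f⇓)) d with Decides⇒⇓ d
... | _ , g⇓ = Decides-cong (λ _ → inj₁ p) (λ _ ())
  (signᴿ-decides (comp⇓ (f⇓ ∷ g⇓ ∷ []) (addᴿ⇓ 1)))
orᴿ-decides (inj₂ (¬p , f⇓)) (inj₁ (q , g⇓)) = Decides-cong (λ _ → inj₂ q) (λ _ ())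
  (signᴿ-decides (comp⇓ (f⇓ ∷ g⇓ ∷ []) (addᴿ⇓ 0)))
orᴿ-decides (inj₂ (¬p , f⇓)) (inj₂ (¬q , g⇓)) = Decides-cong
  (λ 0≢0 → ⊥-elim (0≢0 refl)) (λ { (inj₁ p) → ⊥-elim (¬p p) ; (inj₂ q) → ⊥-elim (¬q q) })
  (signᴿ-decides (comp⇓ (f⇓ ∷ g⇓ ∷ []) (addᴿ⇓ 0)))

andᴿ-decides : Decides f xs P → Decides g xs Q → Decides (andᴿ f g) xs (P × Q)
andᴿ-decides df dg = Decides-cong
  (λ ¬¬p⊎¬q → dne (Decides⇒Dec df) (¬¬p⊎¬q ∘ inj₁) , dne (Decides⇒Dec dg) (¬¬p⊎¬q ∘ inj₂))
  (λ { (p , q) (inj₁ ¬p) → ¬p p ; (p , q) (inj₂ ¬q) → ¬q q })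
  (notᴿ-decides (orᴿ-decides (notᴿ-decides df) (notᴿ-decides dg)))
  where
  dne : Dec P → ¬ ¬ P → P
  dne (yes p) _   = p
  dne (no ¬p) ¬¬p = ⊥-elim (¬¬p ¬p)

-- The given `t` only bounds the search, as fuel, and may come from a classical proof. The value
-- found may be smaller, but it too refutes `P`.
min⇓-decides : ∀ {p} {f : Rec (suc n)} {xs} {P : ℕ → Set p} →
               (∀ t → Decides f (t ∷ xs) (P t)) → ∀ t → ¬ P t →
               ∃ λ t → min f [ xs ]⇓ t × ¬ P t
min⇓-decides {f = f} {xs} {P} d t ¬Pt = search t 0 (λ ()) (subst (¬_ ∘ P) (sym (+-identityʳ t)) ¬Pt)
  where
  search : ∀ fuel s → (∀ {k} → k < s → ∃ λ z → f [ k ∷ xs ]⇓ suc z) →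
           ¬ P (fuel + s) → ∃ λ t → min f [ xs ]⇓ t × ¬ P t
  search fuel s below ¬p with d s
  ... | inj₂ (¬Ps , f⇓) = s , min⇓ below f⇓ , ¬Ps
  search zero s below ¬p | inj₁ (Ps , _) = ⊥-elim (¬p Ps)
  search (suc fuel) s below ¬p | inj₁ (_ , f⇓) = search fuel (suc s) below′
    (subst (¬_ ∘ P) (sym (+-suc fuel s)) ¬p)
    where
    below′ : ∀ {k} → k < suc s → ∃ λ z → f [ k ∷ xs ]⇓ suc z
    below′ {k} k<1+s with m≤n⇒m<n∨m≡n (s≤s⁻¹ k<1+s)
    ... | inj₁ k<s  = below k<s
    ... | inj₂ refl = 0 , f⇓

-- Coding and decoding of lists

parityᴿ halfᴿ : Rec 1
parityᴿ = prec zero (comp isZeroᴿ (proj 1F ∷ []))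
halfᴿ   = prec zero (comp addᴿ (comp parityᴿ (proj 0F ∷ []) ∷ proj 1F ∷ []))

parityᴿ⇓-even : ∀ n → parityᴿ [ 2 * n ∷ [] ]⇓ 0
parityᴿ⇓-odd  : ∀ n → parityᴿ [ suc (2 * n) ∷ [] ]⇓ 1
parityᴿ⇓-even zero    = prec⇓₀ zero⇓
parityᴿ⇓-even (suc n) rewrite *-suc 2 n =
  prec⇓₁ (parityᴿ⇓-odd n) (comp⇓ (proj⇓ ∷ []) (isZeroᴿ⇓₊ 0))
parityᴿ⇓-odd n = prec⇓₁ (parityᴿ⇓-even n) (comp⇓ (proj⇓ ∷ []) isZeroᴿ⇓₀)

halfᴿ⇓-even : ∀ n → halfᴿ [ 2 * n ∷ [] ]⇓ n
halfᴿ⇓-odd  : ∀ n → halfᴿ [ suc (2 * n) ∷ [] ]⇓ n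
halfᴿ⇓-even zero    = prec⇓₀ zero⇓
halfᴿ⇓-even (suc n) rewrite *-suc 2 n = prec⇓₁ (halfᴿ⇓-odd n)
  (comp⇓ (comp⇓ (proj⇓ ∷ []) (parityᴿ⇓-odd n) ∷ proj⇓ ∷ []) (addᴿ⇓ 1))
halfᴿ⇓-odd n = prec⇓₁ (halfᴿ⇓-even n)
  (comp⇓ (comp⇓ (proj⇓ ∷ []) (parityᴿ⇓-even n) ∷ proj⇓ ∷ []) (addᴿ⇓ 0))

halvingsᴿ : Rec 2
halvingsᴿ = prec (proj 0F) (comp halfᴿ (proj 1F ∷ []))

halvingsᴿ⇓ : ∀ x q → halvingsᴿ [ x ∷ 2 ^ x * q ∷ [] ]⇓ q
halvingsᴿ⇓ zero    q rewrite +-identityʳ q = prec⇓₀ proj⇓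
halvingsᴿ⇓ (suc x) q = prec⇓₁
  (subst (λ y → halvingsᴿ [ x ∷ y ∷ [] ]⇓ 2 * q) (lemma (2 ^ x) q) (halvingsᴿ⇓ x (2 * q)))
  (comp⇓ (proj⇓ ∷ []) (halfᴿ⇓-even q))
  where
  lemma : ∀ a b → a * (2 * b) ≡ 2 * a * b
  lemma = solve-∀

-- The head is the exponent of 2 in the code, hence the least number of halvings after which the
-- code is odd. Both functions diverge on the code 0 of the empty list.
headᴿ tailᴿ : Rec 1
headᴿ = min (notᴿ (comp parityᴿ (halvingsᴿ ∷ [])))
tailᴿ = comp halfᴿ (comp halvingsᴿ (headᴿ ∷ proj 0F ∷ []) ∷ [])

headᴿ⇓ : ∀ x xs → headᴿ [ ⌜ x ∷ xs ⌝ ∷ [] ]⇓ x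
headᴿ⇓ x xs = min⇓
  (λ {k} k<x → 0 ,
    comp⇓ (comp⇓ (strip k k<x ∷ []) (parityᴿ⇓-even (2 ^ (x ∸ suc k) * q)) ∷ []) isZeroᴿ⇓₀)
  (comp⇓ (comp⇓ (halvingsᴿ⇓ x _ ∷ []) (parityᴿ⇓-odd ⌜ xs ⌝) ∷ []) (isZeroᴿ⇓₊ 0))
  where
  q = suc (2 * ⌜ xs ⌝)
  lemma : ∀ a b c → a * (2 * (b * c)) ≡ (a * (2 * b)) * c
  lemma = solve-∀
  strip : ∀ k → k < x → halvingsᴿ [ k ∷ ⌜ x ∷ xs ⌝ ∷ [] ]⇓ 2 * (2 ^ (x ∸ suc k) * q)
  strip k k<x =
    subst (λ y → halvingsᴿ [ k ∷ y ∷ [] ]⇓ 2 * (2 ^ (x ∸ suc k) * q)) eq (halvingsᴿ⇓ k _)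
    where
    open ≡-Reasoning
    eq : 2 ^ k * (2 * (2 ^ (x ∸ suc k) * q)) ≡ 2 ^ x * q
    eq = begin
      2 ^ k * (2 * (2 ^ (x ∸ suc k) * q)) ≡⟨ lemma (2 ^ k) (2 ^ (x ∸ suc k)) q ⟩
      2 ^ k * 2 ^ suc (x ∸ suc k) * q     ≡⟨ cong (_* q) (^-distribˡ-+-* 2 k (suc (x ∸ suc k))) ⟨
      2 ^ (k + suc (x ∸ suc k)) * q       ≡⟨ cong (λ y → 2 ^ y * q)
                                                  (trans (+-suc k _) (m+[n∸m]≡n k<x)) ⟩
      2 ^ x * q                           ∎

tailᴿ⇓ : ∀ x xs → tailᴿ [ ⌜ x ∷ xs ⌝ ∷ [] ]⇓ ⌜ xs ⌝
tailᴿ⇓ x xs = comp⇓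
  (comp⇓ (headᴿ⇓ x xs ∷ proj⇓ ∷ []) (halvingsᴿ⇓ x _) ∷ []) (halfᴿ⇓-odd ⌜ xs ⌝)

powᴿ : Rec 1
powᴿ = prec (constᴿ 1) (comp mulᴿ (constᴿ 2 ∷ proj 1F ∷ []))

powᴿ⇓ : ∀ x → powᴿ [ x ∷ [] ]⇓ 2 ^ x
powᴿ⇓ zero    = prec⇓₀ (constᴿ⇓ 1)
powᴿ⇓ (suc x) = prec⇓₁ (powᴿ⇓ x) (comp⇓ (constᴿ⇓ 2 ∷ proj⇓ ∷ []) (mulᴿ⇓ 2))

consᴿ : Rec 2
consᴿ = comp mulᴿ (comp powᴿ (proj 0F ∷ []) ∷
                   comp succ (comp mulᴿ (constᴿ 2 ∷ proj 1F ∷ []) ∷ []) ∷ [])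

consᴿ⇓ : ∀ x xs → consᴿ [ x ∷ ⌜ xs ⌝ ∷ [] ]⇓ ⌜ x ∷ xs ⌝
consᴿ⇓ x xs = comp⇓ (comp⇓ (proj⇓ ∷ []) (powᴿ⇓ x) ∷
  comp⇓ (comp⇓ (constᴿ⇓ 2 ∷ proj⇓ ∷ []) (mulᴿ⇓ 2) ∷ []) succ⇓ ∷ []) (mulᴿ⇓ (2 ^ x))

⌜∷⌝≡suc : ∀ x xs → ∃ λ z → ⌜ x ∷ xs ⌝ ≡ suc z
⌜∷⌝≡suc x xs = _ , sym (suc-pred (2 ^ x * suc (2 * ⌜ xs ⌝)))
  where instance
    _ = m*n≢0 (2 ^ x) (suc (2 * ⌜ xs ⌝)) {{m^n≢0 2 x}}

data Halves : ℕ → Set where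
  even : ∀ n → Halves (2 * n)
  odd  : ∀ n → Halves (suc (2 * n))

halves : ∀ n → Halves n
halves zero = even 0
halves (suc n) with halves n
... | even n = odd n
... | odd n  = subst Halves (*-suc 2 n) (even (suc n))

-- Every round number can thus be decoded. An odd code has head 0; halving a positive even code
-- lowers the head by one.
⌜⌝-surjective : ∀ n → ∃ λ xs → ⌜ xs ⌝ ≡ n
⌜⌝-surjective = <-rec _ go
  where
  go : ∀ n → (∀ {m} → m < n → ∃ λ xs → ⌜ xs ⌝ ≡ m) → ∃ λ xs → ⌜ xs ⌝ ≡ n
  go n rec with halves n
  ... | odd m with rec {m} (s≤s (m≤m+n m _))
  ...   | xs , refl = 0 ∷ xs , +-identityʳ _
  go n rec | even zero = [] , refl
  go n rec | even (suc m) with rec {suc m} (m<m+n (suc m) z<s)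
  ...   | x ∷ xs , eq = suc x ∷ xs , trans (*-assoc 2 (2 ^ x) _) (cong (2 *_) eq)

dropᴿ : Rec 2
dropᴿ = prec (proj 0F) (comp tailᴿ (proj 1F ∷ []))

dropᴿ⇓₁ : ∀ {L} j x xs → dropᴿ [ j ∷ L ∷ [] ]⇓ ⌜ x ∷ xs ⌝ → dropᴿ [ suc j ∷ L ∷ [] ]⇓ ⌜ xs ⌝
dropᴿ⇓₁ j x xs d⇓ = prec⇓₁ d⇓ (comp⇓ (proj⇓ ∷ []) (tailᴿ⇓ x xs))

-- Only the empty list has code 0, and minimisation stops at the first 0, so `dropᴿ` is never run
-- beyond the end of the list.
lengthᴿ : Rec 1
lengthᴿ = min dropᴿ

lengthᴿ⇓ : ∀ xs → lengthᴿ [ ⌜ xs ⌝ ∷ [] ]⇓ length xs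
lengthᴿ⇓ xs = min⇓
  (λ {k} k<l → subst (λ j → ∃ λ z → dropᴿ [ j ∷ ⌜ xs ⌝ ∷ [] ]⇓ suc z) (+-identityʳ k)
    (below k 0 xs (prec⇓₀ proj⇓) k<l))
  (subst (λ j → dropᴿ [ j ∷ ⌜ xs ⌝ ∷ [] ]⇓ 0) (+-identityʳ _) (end 0 xs (prec⇓₀ proj⇓)))
  where
  below : ∀ {L} k j ys → dropᴿ [ j ∷ L ∷ [] ]⇓ ⌜ ys ⌝ → k < length ys →
          ∃ λ z → dropᴿ [ k + j ∷ L ∷ [] ]⇓ suc z
  below {L} zero j (y ∷ ys) d⇓ _ with ⌜∷⌝≡suc y ys
  ... | z , eq = z , subst (dropᴿ [ j ∷ L ∷ [] ]⇓_) eq d⇓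
  below {L} (suc k) j (y ∷ ys) d⇓ k<l =
    subst (λ i → ∃ λ z → dropᴿ [ i ∷ L ∷ [] ]⇓ suc z) (+-suc k j)
      (below k (suc j) ys (dropᴿ⇓₁ j y ys d⇓) (s≤s⁻¹ k<l))
  end : ∀ {L} j ys → dropᴿ [ j ∷ L ∷ [] ]⇓ ⌜ ys ⌝ → dropᴿ [ length ys + j ∷ L ∷ [] ]⇓ 0
  end j []       d⇓ = d⇓
  end {L} j (y ∷ ys) d⇓ = subst (λ i → dropᴿ [ i ∷ L ∷ [] ]⇓ 0) (+-suc (length ys) j)
    (end (suc j) ys (dropᴿ⇓₁ j y ys d⇓))

-- Folds over coded lists

foldLoopᴿ : Rec (2 + n) → Rec (3 + n)
foldLoopᴿ h = prec (proj 1F)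
  (comp h (comp headᴿ (comp dropᴿ (proj 0F ∷ proj 2F ∷ []) ∷ []) ∷ proj 1F ∷ projs 4))

-- The arguments are a coded list, the initial accumulator and the parameters
-- of h; those of h are an element, the accumulator and the parameters.
foldᴿ : Rec (2 + n) → Rec (2 + n)
foldᴿ h = comp (foldLoopᴿ h) (comp lengthᴿ (proj 0F ∷ []) ∷ projs 0)

data Chain (R : ℕ → ℕ → ℕ → Set) : List ℕ → ℕ → ℕ → Set where
  []  : ∀ {a} → Chain R [] a a
  _∷_ : ∀ {x xs a b c} → R x a b → Chain R xs b c → Chain R (x ∷ xs) a c

foldᴿ⇓ : ∀ {h : Rec (2 + n)} {ps xs a c} → Chain (λ x a b → h [ x ∷ a ∷ ps ]⇓ b) xs a c →
         foldᴿ h [ ⌜ xs ⌝ ∷ a ∷ ps ]⇓ c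
foldᴿ⇓ {h = h} {ps} {xs} {a} {c} chain =
  comp⇓ (comp⇓ (proj⇓ ∷ []) (lengthᴿ⇓ xs) ∷ projs⇓ [] (⌜ xs ⌝ ∷ a ∷ ps))
    (subst (Loop c) (+-identityʳ (length xs)) (go 0 xs (prec⇓₀ proj⇓) (prec⇓₀ proj⇓) chain))
  where
  Loop : ℕ → ℕ → Set
  Loop b j = foldLoopᴿ h [ j ∷ ⌜ xs ⌝ ∷ a ∷ ps ]⇓ b

  go : ∀ j ys {b} → Loop b j → dropᴿ [ j ∷ ⌜ xs ⌝ ∷ [] ]⇓ ⌜ ys ⌝ →
       Chain (λ x a b → h [ x ∷ a ∷ ps ]⇓ b) ys b c → Loop c (length ys + j)
  go j []       r⇓ d⇓ []        = r⇓
  go j (y ∷ ys) {b} r⇓ d⇓ (h⇓ ∷ ch) =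
    subst (Loop c) (+-suc (length ys) j)
      (go (suc j) ys
        (prec⇓₁ r⇓ (comp⇓
          (comp⇓ (comp⇓ (proj⇓ ∷ proj⇓ ∷ []) d⇓ ∷ []) (headᴿ⇓ y ys) ∷ proj⇓ ∷
           projs⇓ (j ∷ b ∷ ⌜ xs ⌝ ∷ a ∷ []) ps) h⇓))
        (dropᴿ⇓₁ j y ys d⇓) ch)

anyᴿ : Rec (1 + n) → Rec (1 + n)
anyᴿ f = comp (foldᴿ (orᴿ (proj 1F) (comp f (proj 0F ∷ projs 2)))) (proj 0F ∷ zero ∷ projs 1)

anyᴿ-decides : ∀ {p} {f : Rec (1 + n)} {ps xs} {P : ℕ → Set p} →
  (∀ {x} → x ∈ᴸ xs → Decides f (x ∷ ps) (P x)) → Decides (anyᴿ f) (⌜ xs ⌝ ∷ ps) (Any P xs)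
anyᴿ-decides {p = p} {f = f} {ps} {xs} {P} d = finish (go xs (inj₂ ((λ ()) , refl)) d)
  where
  Bit : ∀ {ℓ} → Set ℓ → ℕ → Set ℓ
  Bit A a = (A × a ≡ 1) ⊎ (¬ A × a ≡ 0)

  R : ℕ → ℕ → ℕ → Set
  R x a b = orᴿ (proj 1F) (comp f (proj 0F ∷ projs 2)) [ x ∷ a ∷ ps ]⇓ b

  bit : ∀ {A : Set p} {x a} → Bit A a → Decides (proj {2 + _} 1F) (x ∷ a ∷ ps) A
  bit (inj₁ (p , refl))  = inj₁ (p , proj⇓)
  bit (inj₂ (¬p , refl)) = inj₂ (¬p , proj⇓)

  weaken : ∀ {x a} → Decides f (x ∷ ps) (P x) →
           Decides (comp f (proj 0F ∷ projs 2)) (x ∷ a ∷ ps) (P x)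
  weaken {x} {a} (inj₁ (p , f⇓)) = inj₁ (p , comp⇓ (proj⇓ ∷ projs⇓ (x ∷ a ∷ []) ps) f⇓)
  weaken {x} {a} (inj₂ (p , f⇓)) = inj₂ (p , comp⇓ (proj⇓ ∷ projs⇓ (x ∷ a ∷ []) ps) f⇓)

  bit-cong : ∀ {A B : Set p} {a} → (A → B) → (B → A) → Bit A a → Bit B a
  bit-cong to from (inj₁ (p , e))  = inj₁ (to p , e)
  bit-cong to from (inj₂ (¬p , e)) = inj₂ (¬p ∘ from , e)

  absorb : ∀ {A : Set p} {y ys} → (A ⊎ P y) ⊎ Any P ys → A ⊎ Any P (y ∷ ys)
  absorb (inj₁ (inj₁ a)) = inj₁ a
  absorb (inj₁ (inj₂ q)) = inj₂ (here q)
  absorb (inj₂ qs)       = inj₂ (there qs)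

  expose : ∀ {A : Set p} {y ys} → A ⊎ Any P (y ∷ ys) → (A ⊎ P y) ⊎ Any P ys
  expose (inj₁ a)          = inj₁ (inj₁ a)
  expose (inj₂ (here q))   = inj₁ (inj₂ q)
  expose (inj₂ (there qs)) = inj₂ qs

  -- `A` stands for the disjunction over the elements already read, whose truth value is the
  -- accumulator.
  go : ∀ {A : Set p} ys {a} → Bit A a → (∀ {x} → x ∈ᴸ ys → Decides f (x ∷ ps) (P x)) →
       ∃ λ c → Chain R ys a c × Bit (A ⊎ Any P ys) c
  go []       {a} p d = a , [] , bit-cong inj₁ (λ { (inj₁ p) → p ; (inj₂ ()) }) p
  go (y ∷ ys) {a} p d with orᴿ-decides (bit p) (weaken (d (here refl)))
  ... | inj₁ (q , ⇓b) with go ys (inj₁ (q , refl)) (d ∘ there)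
  ...   | c , ch , r = c , ⇓b ∷ ch , bit-cong absorb expose r
  go (y ∷ ys) {a} p d | inj₂ (q , ⇓b) with go ys (inj₂ (q , refl)) (d ∘ there)
  ...   | c , ch , r = c , ⇓b ∷ ch , bit-cong absorb expose r

  finish : (∃ λ c → Chain R xs 0 c × Bit (Any P [] ⊎ Any P xs) c) →
           Decides (anyᴿ f) (⌜ xs ⌝ ∷ ps) (Any P xs)
  finish (c , ch , r) with bit-cong {B = Any P xs} (λ { (inj₂ p) → p ; (inj₁ ()) }) inj₂ r
  ... | inj₁ (p , refl) = inj₁ (p , comp⇓ (proj⇓ ∷ zero⇓ ∷ projs⇓ (⌜ xs ⌝ ∷ []) ps) (foldᴿ⇓ ch))
  ... | inj₂ (p , refl) = inj₂ (p , comp⇓ (proj⇓ ∷ zero⇓ ∷ projs⇓ (⌜ xs ⌝ ∷ []) ps) (foldᴿ⇓ ch))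

keepᴿ : Rec (1 + n) → Rec (2 + n)
keepᴿ f = ifᴿ (comp f (proj 0F ∷ projs 2)) (comp consᴿ (proj 0F ∷ proj 1F ∷ [])) (proj 1F)

filterᴿ : Rec (1 + n) → Rec (1 + n)
filterᴿ f = comp (foldᴿ (keepᴿ f)) (proj 0F ∷ zero ∷ projs 1)

filterᴿ⇓ : ∀ {p} {f : Rec (1 + n)} {ps xs} {P : ℕ → Set p} →
  (∀ {x} → x ∈ᴸ xs → Decides f (x ∷ ps) (P x)) →
  ∃ λ zs → filterᴿ f [ ⌜ xs ⌝ ∷ ps ]⇓ ⌜ zs ⌝ ×
    (∀ {x} → x ∈ᴸ zs → x ∈ᴸ xs × P x) × (∀ {x} → x ∈ᴸ xs → P x → x ∈ᴸ zs)
filterᴿ⇓ {f = f} {ps} {xs} {P} d with go xs [] d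
  where
  R : ℕ → ℕ → ℕ → Set
  R x a b = keepᴿ f [ x ∷ a ∷ ps ]⇓ b

  go : ∀ ys as → (∀ {x} → x ∈ᴸ ys → Decides f (x ∷ ps) (P x)) →
       ∃ λ zs → Chain R ys ⌜ as ⌝ ⌜ zs ⌝ × (∀ {x} → x ∈ᴸ zs → x ∈ᴸ as ⊎ (x ∈ᴸ ys × P x)) ×
         as ⊆ᴸ zs × (∀ {x} → x ∈ᴸ ys → P x → x ∈ᴸ zs)
  go []       as d = as , [] , inj₁ , id , λ ()
  go (y ∷ ys) as d with d (here refl)
  ... | inj₁ (p , f⇓) =
    let zs , ch , from , as⊆ , to = go ys (y ∷ as) (d ∘ there)
    in zs ,
       ifᴿ⇓₁ (comp⇓ (proj⇓ ∷ projs⇓ (y ∷ ⌜ as ⌝ ∷ []) ps) f⇓)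
             (comp⇓ (proj⇓ ∷ proj⇓ ∷ []) (consᴿ⇓ y as)) proj⇓ ∷ ch ,
       (λ z∈ → [ (λ { (here refl) → inj₂ (here refl , p) ; (there a∈) → inj₁ a∈ })
               , (λ (z∈ys , q) → inj₂ (there z∈ys , q)) ]′ (from z∈)) ,
       (λ a∈ → as⊆ (there a∈)) ,
       λ { (here refl) _ → as⊆ (here refl) ; (there x∈) q → to x∈ q }
  ... | inj₂ (¬p , f⇓) =
    let zs , ch , from , as⊆ , to = go ys as (d ∘ there)
    in zs ,
       ifᴿ⇓₀ (comp⇓ (proj⇓ ∷ projs⇓ (y ∷ ⌜ as ⌝ ∷ []) ps) f⇓) proj⇓ ∷ ch ,
       (λ z∈ → [ inj₁ , (λ (z∈ys , q) → inj₂ (there z∈ys , q)) ]′ (from z∈)) ,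
       as⊆ ,
       λ { (here refl) p → ⊥-elim (¬p p) ; (there x∈) q → to x∈ q }
... | zs , ch , from , _ , to =
  zs , comp⇓ (proj⇓ ∷ zero⇓ ∷ projs⇓ (⌜ xs ⌝ ∷ []) ps) (foldᴿ⇓ ch) ,
  (λ z∈ → [ (λ ()) , id ]′ (from z∈)) , to

-- The first list ends up reversed in front of the second, which is harmless because lists serve as
-- finite sets here.
appendᴿ : Rec 2
appendᴿ = foldᴿ consᴿ

appendᴿ⇓ : ∀ xs as → appendᴿ [ ⌜ xs ⌝ ∷ ⌜ as ⌝ ∷ [] ]⇓ ⌜ reverseAcc as xs ⌝
appendᴿ⇓ xs as = foldᴿ⇓ (go xs as)
  where
  go : ∀ xs as → Chain (λ x a b → consᴿ [ x ∷ a ∷ [] ]⇓ b) xs ⌜ as ⌝ ⌜ reverseAcc as xs ⌝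
  go []       as = []
  go (x ∷ xs) as = consᴿ⇓ x as ∷ go xs (x ∷ as)

-- Loops that only add elements to a list

Extends : ∀ {p} → (ℕ → Set p) → List ℕ → (List ℕ → Set p) → (ℕ → Set) → Set p
Extends Good as T Result = ∃ λ bs → Result ⌜ bs ⌝ × All Good bs × as ⊆ᴸ bs × T bs

module _ {p} {Good : ℕ → Set p} {T : ℕ → List ℕ → Set p}
  (T-mono : ∀ {x as bs} → as ⊆ᴸ bs → T x as → T x bs) where

  -- What is achieved when `x` is processed survives the later iterations, because they only enlarge
  -- the list and `T` is monotone in it.
  foldᴿ-extends : ∀ {h : Rec (2 + n)} {ps} xs {as} →
    (∀ {x as} → x ∈ᴸ xs → All Good as → Extends Good as (T x) (h [ x ∷ ⌜ as ⌝ ∷ ps ]⇓_)) →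
    All Good as →
    Extends Good as (λ bs → ∀ {x} → x ∈ᴸ xs → T x bs) (foldᴿ h [ ⌜ xs ⌝ ∷ ⌜ as ⌝ ∷ ps ]⇓_)
  foldᴿ-extends {h = h} {ps} xs ext good =
    let bs , ch , rest = go xs ext good in bs , foldᴿ⇓ ch , rest
    where
    go : ∀ xs {as} →
      (∀ {x as} → x ∈ᴸ xs → All Good as → Extends Good as (T x) (h [ x ∷ ⌜ as ⌝ ∷ ps ]⇓_)) →
      All Good as →
      Extends Good as (λ bs → ∀ {x} → x ∈ᴸ xs → T x bs)
        (Chain (λ x a b → h [ x ∷ a ∷ ps ]⇓ b) xs ⌜ as ⌝)
    go []       {as} ext good = as , [] , good , id , λ ()
    go (x ∷ xs) ext good =
      let bs , h⇓ , good′ , as⊆bs , t = ext (here refl) good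
          cs , ch , good″ , bs⊆cs , ts = go xs (ext ∘ there) good′
      in cs , h⇓ ∷ ch , good″ , (λ a∈ → bs⊆cs (as⊆bs a∈)) ,
         λ { (here refl) → T-mono bs⊆cs t ; (there x∈) → ts x∈ }

  prec-extends : ∀ {g : Rec n} {h : Rec (2 + n)} {ps} k {as} → g [ ps ]⇓ ⌜ as ⌝ →
    (∀ {j as} → j < k → All Good as → Extends Good as (T j) (h [ j ∷ ⌜ as ⌝ ∷ ps ]⇓_)) →
    All Good as →
    Extends Good as (λ bs → ∀ {j} → j < k → T j bs) (prec g h [ k ∷ ps ]⇓_)
  prec-extends zero    {as} g⇓ ext good = as , prec⇓₀ g⇓ , good , id , λ ()
  prec-extends (suc k) {as} g⇓ ext good =
    let bs , r⇓ , good′ , as⊆bs , ts = prec-extends k g⇓ (λ j<k → ext (m<n⇒m<1+n j<k)) good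
        cs , h⇓ , good″ , bs⊆cs , t = ext ≤-refl good′
    in cs , prec⇓₁ r⇓ h⇓ , good″ , (λ a∈ → bs⊆cs (as⊆bs a∈)) ,
       λ j<1+k → [ (λ j<k → T-mono bs⊆cs (ts j<k)) , (λ { refl → t }) ]′ (m≤n⇒m<n∨m≡n (s≤s⁻¹ j<1+k))

-- Shows that a list with head `t` has a code above `t`, so a word can be scheduled no earlier than
-- any given round.
n<2^n : ∀ n → n < 2 ^ n
n<2^n zero    = z<s
n<2^n (suc n) = ≤-trans (+-mono-≤ (m^n>0 2 n) (n<2^n n))
  (≤-reflexive (cong (2 ^ n +_) (sym (+-identityʳ (2 ^ n)))))

comp-decides : ∀ {p} {P : Set p} {f : Rec m} {gs : Vec (Rec n) m} {xs ys} →
  VecPointwise.Pointwise (λ g y → g [ xs ]⇓ y) gs ys → Decides f ys P → Decides (comp f gs) xs P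
comp-decides gs⇓ (inj₁ (p , f⇓))  = inj₁ (p , comp⇓ gs⇓ f⇓)
comp-decides gs⇓ (inj₂ (¬p , f⇓)) = inj₂ (¬p , comp⇓ gs⇓ f⇓)

module _ {a b r} {A : Set a} {B : Set b} {R : A → B → Set r} where

  Pointwise-left : ∀ {xs ys y} → Pointwise R xs ys → y ∈ᴸ ys → ∃ λ x → x ∈ᴸ xs × R x y
  Pointwise-left (r ∷ rs) (here refl) = _ , here refl , r
  Pointwise-left (r ∷ rs) (there y∈)  = let x , x∈ , r = Pointwise-left rs y∈ in x , there x∈ , r

  Pointwise-right : ∀ {xs ys x} → Pointwise R xs ys → x ∈ᴸ xs → ∃ λ y → y ∈ᴸ ys × R x y
  Pointwise-right (r ∷ rs) (here refl) = _ , here refl , r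
  Pointwise-right (r ∷ rs) (there x∈)  = let y , y∈ , r = Pointwise-right rs x∈ in y , there y∈ , r

-- Makes the word of a round well defined. Parity separates head 0 from a positive head, and two
-- positive heads are lowered together by cancelling a factor 2.
⌜⌝-injective : ∀ {xs ys} → ⌜ xs ⌝ ≡ ⌜ ys ⌝ → xs ≡ ys
⌜∷⌝-injective : ∀ x y {xs ys} → ⌜ x ∷ xs ⌝ ≡ ⌜ y ∷ ys ⌝ → x ∷ xs ≡ y ∷ ys

⌜⌝-injective {[]}     {[]}     _  = refl
⌜⌝-injective {[]}     {y ∷ ys} eq with () ← trans eq (proj₂ (⌜∷⌝≡suc y ys))
⌜⌝-injective {x ∷ xs} {[]}     eq with () ← trans (sym (proj₂ (⌜∷⌝≡suc x xs))) eq
⌜⌝-injective {x ∷ xs} {y ∷ ys} eq = ⌜∷⌝-injective x y eq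

⌜∷⌝-injective zero zero {xs} {ys} eq = cong (0 ∷_) (⌜⌝-injective
  (*-cancelˡ-≡ ⌜ xs ⌝ ⌜ ys ⌝ 2 (suc-injective
    (trans (sym (*-identityˡ (suc (2 * ⌜ xs ⌝)))) (trans eq (*-identityˡ (suc (2 * ⌜ ys ⌝))))))))
⌜∷⌝-injective zero (suc y) {xs} {ys} eq = ⊥-elim (even≢odd (2 ^ y * suc (2 * ⌜ ys ⌝)) ⌜ xs ⌝
  (trans (sym (*-assoc 2 (2 ^ y) _)) (trans (sym eq) (*-identityˡ (suc (2 * ⌜ xs ⌝))))))
⌜∷⌝-injective (suc x) zero {xs} {ys} eq = ⊥-elim (even≢odd (2 ^ x * suc (2 * ⌜ xs ⌝)) ⌜ ys ⌝
  (trans (sym (*-assoc 2 (2 ^ x) _)) (trans eq (*-identityˡ (suc (2 * ⌜ ys ⌝))))))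
⌜∷⌝-injective (suc x) (suc y) {xs} {ys} eq = cong (λ { [] → [] ; (z ∷ zs) → suc z ∷ zs })
  (⌜∷⌝-injective x y {xs} {ys} (*-cancelˡ-≡ ⌜ x ∷ xs ⌝ ⌜ y ∷ ys ⌝ 2
    (trans (sym (*-assoc 2 (2 ^ x) _)) (trans eq (*-assoc 2 (2 ^ y) _)))))

⌜∷⌝≢0 : ∀ x xs → ⌜ x ∷ xs ⌝ ≢ 0
⌜∷⌝≢0 x xs eq with () ← trans (sym (proj₂ (⌜∷⌝≡suc x xs))) eq

-- The saturation algorithm

-- Letters of argument lists: s codes the system, c an ideal, j a letter, u a
-- word, L a list of ideals, and a is an accumulator, also a list of ideals.
module Algorithm
  (alphabet : Rec 1) (post accelerate inclusion : Rec 3) (principalCode : Rec 2) where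

  -- [ j , a , initial a , c , s ]
  postsOfᴿ : Rec 5
  postsOfᴿ = comp appendᴿ (comp post (proj 4F ∷ proj 3F ∷ proj 0F ∷ []) ∷ proj 1F ∷ [])

  -- [ c , a , s ]
  expandᴿ : Rec 3
  expandᴿ = comp (prec (proj 0F) postsOfᴿ)
    (comp alphabet (proj 2F ∷ []) ∷ proj 1F ∷ proj 0F ∷ proj 2F ∷ [])

  -- [ c , a , u , s ]
  accelᴿ : Rec 4
  accelᴿ = comp consᴿ (comp accelerate (proj 3F ∷ proj 0F ∷ proj 2F ∷ []) ∷ proj 1F ∷ [])

  -- [ j , s ], where j ≥ ∣Σ∣ is foreign
  foreignᴿ : Rec 2
  foreignᴿ = notᴿ (notᴿ
    (comp monusᴿ (comp alphabet (proj 1F ∷ []) ∷ comp succ (proj 0F ∷ []) ∷ [])))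

  -- [ u , s ]; the empty word is rejected
  isWordᴿ : Rec 2
  isWordᴿ = andᴿ (notᴿ (notᴿ (proj 0F))) (notᴿ (anyᴿ foreignᴿ))

  -- [ t , L , s ]; 1 + t is the code of a nonempty list, whose tail is the word
  -- used in round t.
  wordᴿ expandedᴿ stepᴿ : Rec 3
  wordᴿ     = comp tailᴿ (comp succ (proj 0F ∷ []) ∷ [])
  expandedᴿ = comp (foldᴿ expandᴿ) (proj 1F ∷ proj 1F ∷ proj 2F ∷ [])
  stepᴿ     = ifᴿ (comp isWordᴿ (wordᴿ ∷ proj 2F ∷ []))
                  (comp (foldᴿ accelᴿ) (proj 1F ∷ expandedᴿ ∷ wordᴿ ∷ proj 2F ∷ []))
                  expandedᴿ

  -- [ t , c , s ]
  roundsᴿ : Rec 3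
  roundsᴿ = prec (comp consᴿ (proj 0F ∷ zero ∷ [])) (comp stepᴿ (proj 0F ∷ proj 1F ∷ proj 3F ∷ []))

  -- [ c , L , s ]
  coveredᴿ : Rec 3
  coveredᴿ = comp (anyᴿ (comp inclusion (proj 2F ∷ proj 1F ∷ proj 0F ∷ [])))
                  (proj 1F ∷ proj 0F ∷ proj 2F ∷ [])

  -- [ t , c , s ]
  unstableᴿ : Rec 3
  unstableᴿ = comp (anyᴿ (notᴿ coveredᴿ))
    (comp roundsᴿ (comp succ (proj 0F ∷ []) ∷ proj 1F ∷ proj 2F ∷ []) ∷ roundsᴿ ∷ proj 2F ∷ [])

  -- [ c , s ]
  stableᴿ : Rec 2
  stableᴿ = comp roundsᴿ (min unstableᴿ ∷ proj 0F ∷ proj 1F ∷ [])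

  -- [ c , L , s ]
  dominatedᴿ : Rec 3
  dominatedᴿ = comp
    (anyᴿ (andᴿ (comp inclusion (proj 2F ∷ proj 1F ∷ proj 0F ∷ []))
                (notᴿ (comp inclusion (proj 2F ∷ proj 0F ∷ proj 1F ∷ [])))))
    (proj 1F ∷ proj 0F ∷ proj 2F ∷ [])

  -- [ L , s ]
  maximaᴿ : Rec 2
  maximaᴿ = comp (filterᴿ (notᴿ dominatedᴿ)) (proj 0F ∷ proj 0F ∷ proj 1F ∷ [])

  clover : Rec 2
  clover = comp maximaᴿ (comp stableᴿ (principalCode ∷ proj 0F ∷ []) ∷ proj 0F ∷ [])

  coverable : Rec 3
  coverable = comp coveredᴿ
    (comp principalCode (proj 0F ∷ proj 2F ∷ []) ∷
     comp clover (proj 0F ∷ proj 1F ∷ []) ∷ proj 0F ∷ [])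

-- Correctness of the saturation algorithm

module Correctness
  (lem : ExcludedMiddle (lsuc 0ℓ)) (𝒞 : SystemClass) (E : CompletionPostEffective 𝒞)
  (A : ∞-CompletionEffective 𝒞 E) (i : SystemClass.Index 𝒞)
  (very : IsVeryWSTS (SystemClass.system 𝒞 i))
  (s : ℕ) (s⊩i : SystemClass._codesSystem_ 𝒞 s i)
  (x : TransitionSystem.State (SystemClass.system 𝒞 i)) where

  open SystemClass 𝒞 hiding (system)
  open CompletionPostEffective E
  open ∞-CompletionEffective A
  open Algorithm alphabet post accelerate inclusion principalCode

  private
    S : System
    S = SystemClass.system 𝒞 i

  open TransitionSystem S
  open Preorder states using () renaming (refl to ≲-refl; trans to ≲-trans)
  open Theory lem S very
  private module C = TransitionSystem (completion S)
  open C using () renaming (_≲_ to _⊑_; step to _⇒_)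
  open Representation (idealRep i)
    using (_⊩_; ⊩-resp; functional; Computes; ComputesFiniteSet)

  Good : ℕ → Set₁
  Good c = ∃ λ J → c ⊩ J × Sound x J

  Coded : ℕ → Set₁
  Coded c = ∃ λ J → c ⊩ J

  good-coded : ∀ {c} → Good c → Coded c
  good-coded (J , c⊩J , _) = J , c⊩J

  good-sound : ∀ {c} J → Good c → c ⊩ J → Sound x J
  good-sound J (K , c⊩K , K-sound) c⊩J z∈J = K-sound (proj₁ (functional c⊩J c⊩K) z∈J)

  -- Quantifying over the coded ideals gives a relation on plain numbers, as the list programs
  -- require. Since a code determines its ideal, the choice of `J` and `K` does not matter.
  _⊑ᶜ_ : ℕ → ℕ → Set₁
  c ⊑ᶜ d = ∃₂ λ J K → c ⊩ J × d ⊩ K × J ⊑ K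

  ⊑ᶜ⇒⊑ : ∀ {c d} J K → c ⊩ J → d ⊩ K → c ⊑ᶜ d → J ⊑ K
  ⊑ᶜ⇒⊑ J K c⊩J d⊩K (J′ , K′ , c⊩J′ , d⊩K′ , J′⊑K′) z∈J =
    proj₁ (functional d⊩K′ d⊩K) (J′⊑K′ (proj₁ (functional c⊩J c⊩J′) z∈J))

  inclusion-decides : ∀ {c d} → Coded c → Coded d → Decides inclusion (s ∷ c ∷ d ∷ []) (c ⊑ᶜ d)
  inclusion-decides (J , c⊩J) (K , d⊩K) with inclusion⇓ s⊩i c⊩J d⊩K
  ... | inj₁ (J⊑K , f⇓) = inj₁ ((J , K , c⊩J , d⊩K , J⊑K) , f⇓)
  ... | inj₂ (J⋢K , f⇓) = inj₂ ((λ c⊑d → J⋢K (⊑ᶜ⇒⊑ J K c⊩J d⊩K c⊑d)) , f⇓)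

  coded-mono : ∀ {as bs J} → as ⊆ᴸ bs → (∃ λ d → d ∈ᴸ as × d ⊩ J) → ∃ λ d → d ∈ᴸ bs × d ⊩ J
  coded-mono as⊆bs (d , d∈ , d⊩J) = d , as⊆bs d∈ , d⊩J

  -- The loop counter is a number, so the letter enters through the equation with `toℕ b`. Ranging
  -- over every ideal coded by `c` frees later uses from the decoding chosen inside the loop.
  HasPost : ℕ → ℕ → List ℕ → Set₁
  HasPost c j bs = ∀ {b} → toℕ b ≡ j → ∀ I J → c ⊩ I → (b ⇒ I) J → ∃ λ d → d ∈ᴸ bs × d ⊩ J

  HasPosts : ℕ → List ℕ → Set₁
  HasPosts c bs = ∀ {b} I J → c ⊩ I → (b ⇒ I) J → ∃ λ d → d ∈ᴸ bs × d ⊩ J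

  HasAccel : Letter → Word → ℕ → List ℕ → Set₁
  HasAccel b w c bs = ∀ I K → c ⊩ I → IsAcceleration S (b ∷ w) I K → ∃ λ d → d ∈ᴸ bs × d ⊩ K

  all-good : ∀ {cs Js} → Pointwise _⊩_ cs Js →
    (∀ J → Any (λ K → members J ≐ members K) Js → Sound x J) → All Good cs
  all-good []         sound = []
  all-good {Js = J ∷ _} (r ∷ rs) sound =
    (J , r , sound J (here (id , id))) ∷ all-good rs (λ J J∈ → sound J (there J∈))

  postsOfᴿ⇓ : ∀ {c acc₀ j as} → j < ∣Σ∣ → Good c → All Good as →
    Extends Good as (HasPost c j) (postsOfᴿ [ j ∷ ⌜ as ⌝ ∷ acc₀ ∷ c ∷ s ∷ [] ]⇓_)
  postsOfᴿ⇓ {c} {acc₀} {j} {as} j<σ (I , c⊩I , I-sound) good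
    with post⇓ s⊩i c⊩I (fromℕ< j<σ)
  ... | cs , Js , f⇓ , cs⊩Js , Js-posts =
    reverseAcc as cs ,
    comp⇓ (comp⇓ (proj⇓ ∷ proj⇓ ∷ proj⇓ ∷ []) f⇓′ ∷ proj⇓ ∷ []) (appendᴿ⇓ cs as) ,
    All.tabulate (λ d∈ → [ All.lookup good , All.lookup good′ ]′ (reverseAcc⁻ as cs d∈)) ,
    (λ a∈ → reverseAcc⁺ as cs (inj₁ a∈)) ,
    has
    where
    f⇓′ : post [ s ∷ c ∷ j ∷ [] ]⇓ ⌜ cs ⌝
    f⇓′ = subst (λ j → post [ s ∷ c ∷ j ∷ [] ]⇓ ⌜ cs ⌝) (toℕ-fromℕ< j<σ) f⇓

    good′ : All Good cs
    good′ = all-good cs⊩Js λ J J∈ → post-sound I J (Equivalence.from (Js-posts J) J∈) I-sound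

    has : HasPost c j (reverseAcc as cs)
    has {b} refl I′ J c⊩I′ I′⇒J =
      let b≡ : fromℕ< j<σ ≡ b
          b≡ = fromℕ<-toℕ b j<σ
          I⇒J : (fromℕ< j<σ ⇒ I) J
          I⇒J = subst (λ b → (b ⇒ I) J) (sym b≡)
                  (proj₂ (C.step-resp b) {J} {I′} {I} (functional c⊩I′ c⊩I) I′⇒J)
          K , K∈ , J≈K = find (Equivalence.to (Js-posts J) I⇒J)
          d , d∈ , d⊩K = Pointwise-left cs⊩Js K∈
      in d , reverseAcc⁺ as cs (inj₂ d∈) , ⊩-resp (proj₂ J≈K , proj₁ J≈K) d⊩K

  expandᴿ⇓ : ∀ {c as} → Good c → All Good as →
    Extends Good as (HasPosts c) (expandᴿ [ c ∷ ⌜ as ⌝ ∷ s ∷ [] ]⇓_)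
  expandᴿ⇓ {c} {as} c-good good =
    let bs , r⇓ , good′ , as⊆bs , has = prec-extends {T = HasPost c}
          (λ sub t {b} b≡j I J c⊩I I⇒J → coded-mono {J = J} sub (t {b} b≡j I J c⊩I I⇒J))
          ∣Σ∣ proj⇓ (λ j<σ → postsOfᴿ⇓ j<σ c-good) good
    in bs , comp⇓ (comp⇓ (proj⇓ ∷ []) (alphabet⇓ s⊩i) ∷ proj⇓ ∷ proj⇓ ∷ proj⇓ ∷ []) r⇓ ,
       good′ , as⊆bs , λ {b} → has (toℕ<n b) {b} refl

  accelᴿ⇓ : ∀ b w {c as} → Good c → All Good as →
    Extends Good as (HasAccel b w c)
      (accelᴿ [ c ∷ ⌜ as ⌝ ∷ ⌜ map toℕ (b ∷ w) ⌝ ∷ s ∷ [] ]⇓_)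
  accelᴿ⇓ b w {c} {as} (I , c⊩I , I-sound) good with accelerate⇓ s⊩i c⊩I b w
  ... | d , K , f⇓ , d⊩K , K-accel =
    d ∷ as , comp⇓ (comp⇓ (proj⇓ ∷ proj⇓ ∷ proj⇓ ∷ []) f⇓ ∷ proj⇓ ∷ []) (consᴿ⇓ d as) ,
    (K , d⊩K , acceleration-sound {I = I} {K} K-accel I-sound) ∷ good , there ,
    λ I′ K′ c⊩I′ K′-accel → d , here refl ,
      ⊩-resp (acceleration-unique {I = I} {K} {K′} K-accel
        (acceleration-resp I′ I K′ (functional c⊩I′ c⊩I) K′-accel)) d⊩K

  Foreign : ℕ → Set
  Foreign y = suc y ∸ ∣Σ∣ ≢ 0

  isWordᴿ-decides : ∀ us → Decides isWordᴿ (⌜ us ⌝ ∷ s ∷ []) (⌜ us ⌝ ≢ 0 × ¬ Any Foreign us)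
  isWordᴿ-decides us = andᴿ-decides (signᴿ-decides proj⇓)
    (notᴿ-decides (anyᴿ-decides λ _ → signᴿ-decides
      (comp⇓ (comp⇓ (proj⇓ ∷ []) (alphabet⇓ s⊩i) ∷ comp⇓ (proj⇓ ∷ []) succ⇓ ∷ []) (monusᴿ⇓ ∣Σ∣))))

  letter : ∀ {y} → ¬ Foreign y → ∃ λ (b : Letter) → y ≡ toℕ b
  letter {y} ¬foreign = fromℕ< y<σ , sym (toℕ-fromℕ< y<σ)
    where
    y<σ : y < ∣Σ∣
    y<σ = m∸n≡0⇒m≤n (decidable-stable (suc y ∸ ∣Σ∣ ≟ 0) ¬foreign)

  word : ∀ us → ¬ Any Foreign us → ∃ λ (w : Word) → us ≡ map toℕ w
  word []       _  = [] , refl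
  word (u ∷ us) ¬f =
    let b , u≡b  = letter (λ f → ¬f (here f))
        w , us≡w = word us (λ f → ¬f (there f))
    in b ∷ w , cong₂ _∷_ u≡b us≡w

  word-native : ∀ (w : Word) → ¬ Any Foreign (map toℕ w)
  word-native (b ∷ w) (here f)  = f (m≤n⇒m∸n≡0 (toℕ<n b))
  word-native (b ∷ w) (there f) = word-native w f

  map-toℕ-injective : ∀ {v w : Word} → map toℕ v ≡ map toℕ w → v ≡ w
  map-toℕ-injective = map-injective toℕ-injective

  Next : ℕ → List ℕ → List ℕ → Set₁
  Next t as bs =
    (∀ {c} → c ∈ᴸ as → HasPosts c bs) ×
    (∀ k b w → suc t ≡ ⌜ k ∷ map toℕ (b ∷ w) ⌝ → ∀ {c} → c ∈ᴸ as → HasAccel b w c bs)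

  expandAllᴿ⇓ : ∀ {as} → All Good as →
    Extends Good as (λ bs → ∀ {c} → c ∈ᴸ as → HasPosts c bs)
      (foldᴿ expandᴿ [ ⌜ as ⌝ ∷ ⌜ as ⌝ ∷ s ∷ [] ]⇓_)
  expandAllᴿ⇓ {as} good = foldᴿ-extends {T = HasPosts}
    (λ sub t {b} I J c⊩I I⇒J → coded-mono {J = J} sub (t {b} I J c⊩I I⇒J)) as
    (λ c∈ → expandᴿ⇓ (All.lookup good c∈)) good

  accelAllᴿ⇓ : ∀ b w {as bs} → All Good as → All Good bs →
    Extends Good bs (λ cs → ∀ {c} → c ∈ᴸ as → HasAccel b w c cs)
      (foldᴿ accelᴿ [ ⌜ as ⌝ ∷ ⌜ bs ⌝ ∷ ⌜ map toℕ (b ∷ w) ⌝ ∷ s ∷ [] ]⇓_)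
  accelAllᴿ⇓ b w {as} good good′ = foldᴿ-extends {T = HasAccel b w}
    (λ sub t I K c⊩I a → coded-mono {J = K} sub (t I K c⊩I a)) as
    (λ c∈ → accelᴿ⇓ b w (All.lookup good c∈)) good′

  module _ {t as} k us (good : All Good as) (codes : ⌜ k ∷ us ⌝ ≡ suc t) where

    wordᴿ⇓ : wordᴿ [ t ∷ ⌜ as ⌝ ∷ s ∷ [] ]⇓ ⌜ us ⌝
    wordᴿ⇓ = comp⇓ (comp⇓ (proj⇓ ∷ []) succ⇓ ∷ [])
      (subst (λ y → tailᴿ [ y ∷ [] ]⇓ ⌜ us ⌝) codes (tailᴿ⇓ k us))

    same-word : ∀ l vs → suc t ≡ ⌜ l ∷ vs ⌝ → us ≡ vs
    same-word l vs eq = ∷-injectiveʳ (⌜⌝-injective {k ∷ us} {l ∷ vs} (trans codes eq))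

    module _ {bs} (expanded⇓ : expandedᴿ [ t ∷ ⌜ as ⌝ ∷ s ∷ [] ]⇓ ⌜ bs ⌝) (good′ : All Good bs)
             (as⊆bs : as ⊆ᴸ bs) (posts : ∀ {c} → c ∈ᴸ as → HasPosts c bs) where

      stepᴿ⇓-no-word : comp isWordᴿ (wordᴿ ∷ proj 2F ∷ []) [ t ∷ ⌜ as ⌝ ∷ s ∷ [] ]⇓ 0 →
             ¬ (⌜ us ⌝ ≢ 0 × ¬ Any Foreign us) →
             Extends Good as (Next t as) (stepᴿ [ t ∷ ⌜ as ⌝ ∷ s ∷ [] ]⇓_)
      stepᴿ⇓-no-word f⇓ ¬word =
        bs , ifᴿ⇓₀ f⇓ expanded⇓ , good′ , (λ {y} → as⊆bs {y}) , (λ {c} → posts {c}) ,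
        -- The demand about accelerations is vacuous: by injectivity of the coding, a nonempty word
        -- over the alphabet in this round would be `us`, which failed the test.
        λ l b w eq → ⊥-elim (¬word (subst (λ us → ⌜ us ⌝ ≢ 0 × ¬ Any Foreign us)
          (sym (same-word l (map toℕ (b ∷ w)) eq))
          (⌜∷⌝≢0 (toℕ b) (map toℕ w) , word-native (b ∷ w))))

      stepᴿ⇓-word : ∀ b w → us ≡ map toℕ (b ∷ w) → 
             comp isWordᴿ (wordᴿ ∷ proj 2F ∷ []) [ t ∷ ⌜ as ⌝ ∷ s ∷ [] ]⇓ 1 →
             Extends Good as (Next t as) (stepᴿ [ t ∷ ⌜ as ⌝ ∷ s ∷ [] ]⇓_)
      stepᴿ⇓-word b w us≡ f⇓ with accelAllᴿ⇓ b w good good′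
      ... | cs , accel⇓ , good″ , bs⊆cs , accels = cs ,
        ifᴿ⇓₁ f⇓ (comp⇓ (proj⇓ ∷ expanded⇓ ∷ wordᴿ⇓ ∷ proj⇓ ∷ []) accel⇓′) expanded⇓ ,
        good″ , (λ a∈ → bs⊆cs (as⊆bs a∈)) ,
        (λ c∈ {b} I J c⊩I I⇒J → coded-mono {J = J} bs⊆cs (posts c∈ {b} I J c⊩I I⇒J)) ,
        λ l b′ w′ eq c∈ I K c⊩I K-accel → accels c∈ I K c⊩I
          (subst (λ v → IsAcceleration S v I K)
            (map-toℕ-injective {b′ ∷ w′} {b ∷ w}
              (trans (sym (same-word l (map toℕ (b′ ∷ w′)) eq)) us≡)) K-accel)
        where
        accel⇓′ : foldᴿ accelᴿ [ ⌜ as ⌝ ∷ ⌜ bs ⌝ ∷ ⌜ us ⌝ ∷ s ∷ [] ]⇓ ⌜ cs ⌝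
        accel⇓′ = subst (λ us → foldᴿ accelᴿ [ ⌜ as ⌝ ∷ ⌜ bs ⌝ ∷ ⌜ us ⌝ ∷ s ∷ [] ]⇓ ⌜ cs ⌝)
                    (sym us≡) accel⇓

  abstract
    stepᴿ⇓ : ∀ t {as} → All Good as →
      Extends Good as (Next t as) (stepᴿ [ t ∷ ⌜ as ⌝ ∷ s ∷ [] ]⇓_)
    stepᴿ⇓ t {as} good = decode (⌜⌝-surjective (suc t)) (expandAllᴿ⇓ good)
      where
      decode : (∃ λ ks → ⌜ ks ⌝ ≡ suc t) →
        Extends Good as (λ bs → ∀ {c} → c ∈ᴸ as → HasPosts c bs)
          (foldᴿ expandᴿ [ ⌜ as ⌝ ∷ ⌜ as ⌝ ∷ s ∷ [] ]⇓_) →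
        Extends Good as (Next t as) (stepᴿ [ t ∷ ⌜ as ⌝ ∷ s ∷ [] ]⇓_)
      decode (k ∷ us , eq) (bs , fold⇓ , good′ , as⊆bs , posts) = branch (isWordᴿ-decides us)
        where
        expanded⇓ : expandedᴿ [ t ∷ ⌜ as ⌝ ∷ s ∷ [] ]⇓ ⌜ bs ⌝
        expanded⇓ = comp⇓ (proj⇓ ∷ proj⇓ ∷ proj⇓ ∷ []) fold⇓

        branch : Decides isWordᴿ (⌜ us ⌝ ∷ s ∷ []) (⌜ us ⌝ ≢ 0 × ¬ Any Foreign us) →
                 Extends Good as (Next t as) (stepᴿ [ t ∷ ⌜ as ⌝ ∷ s ∷ [] ]⇓_)
        branch (inj₂ (¬word , f⇓)) =
          stepᴿ⇓-no-word k us good eq expanded⇓ good′ as⊆bs posts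
            (comp⇓ (wordᴿ⇓ k us good eq ∷ proj⇓ ∷ []) f⇓) ¬word
        branch (inj₁ ((us≢0 , native) , f⇓)) = nonempty (word us native)
          where
          nonempty : (∃ λ (w : Word) → us ≡ map toℕ w) →
                     Extends Good as (Next t as) (stepᴿ [ t ∷ ⌜ as ⌝ ∷ s ∷ [] ]⇓_)
          nonempty ([]    , us≡) = ⊥-elim (us≢0 (cong ⌜_⌝ us≡))
          nonempty (b ∷ w , us≡) =
            stepᴿ⇓-word k us good eq expanded⇓ good′ as⊆bs posts b w us≡
              (comp⇓ (wordᴿ⇓ k us good eq ∷ proj⇓ ∷ []) f⇓)

  coveredᴿ-decides : ∀ {d cs} → Coded d → (∀ {c} → c ∈ᴸ cs → Coded c) →
    Decides coveredᴿ (d ∷ ⌜ cs ⌝ ∷ s ∷ []) (Any (d ⊑ᶜ_) cs)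
  coveredᴿ-decides d-coded coded = comp-decides (proj⇓ ∷ proj⇓ ∷ proj⇓ ∷ [])
    (anyᴿ-decides λ c∈ → comp-decides (proj⇓ ∷ proj⇓ ∷ proj⇓ ∷ [])
      (inclusion-decides d-coded (coded c∈)))

  -- Domination is strict, so that several codes of one ideal do not eliminate each other; the
  -- resulting repetitions are allowed in the output.
  Dominated : List ℕ → ℕ → Set₁
  Dominated cs c = Any (λ d → c ⊑ᶜ d × ¬ d ⊑ᶜ c) cs

  dominatedᴿ-decides : ∀ {c cs} → Coded c → (∀ {d} → d ∈ᴸ cs → Coded d) →
    Decides dominatedᴿ (c ∷ ⌜ cs ⌝ ∷ s ∷ []) (Dominated cs c)
  dominatedᴿ-decides c-coded coded = comp-decides (proj⇓ ∷ proj⇓ ∷ proj⇓ ∷ [])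
    (anyᴿ-decides λ d∈ → andᴿ-decides
      (comp-decides (proj⇓ ∷ proj⇓ ∷ proj⇓ ∷ []) (inclusion-decides c-coded (coded d∈)))
      (notᴿ-decides
        (comp-decides (proj⇓ ∷ proj⇓ ∷ proj⇓ ∷ []) (inclusion-decides (coded d∈) c-coded))))

  decode : ∀ {cs} → All Good cs → ∃ λ Is → Pointwise _⊩_ cs Is
  decode []                    = [] , []
  decode ((I , c⊩I , _) ∷ good) = let Is , rs = decode good in I ∷ Is , c⊩I ∷ rs

  D : State → Set
  D = ↓ (Post* x)

  module Saturation {c₀ : ℕ} (c₀⊩ : c₀ ⊩ principal states x) where

    -- The lists are read off the correctness proof of `stepᴿ`, which also supplies the computation
    -- that produces them.
    round : ℕ → Σ (List ℕ) (All Good)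
    round zero    = c₀ ∷ [] , (principal states x , c₀⊩ , principal-sound x) ∷ []
    round (suc t) = let bs , _ , good , _ = stepᴿ⇓ t (proj₂ (round t)) in bs , good

    codes : ℕ → List ℕ
    codes t = proj₁ (round t)

    good : ∀ t → All Good (codes t)
    good t = proj₂ (round t)

    coded : ∀ t {c} → c ∈ᴸ codes t → Coded c
    coded t c∈ = good-coded (All.lookup (good t) c∈)

    roundsᴿ⇓ : ∀ t → roundsᴿ [ t ∷ c₀ ∷ s ∷ [] ]⇓ ⌜ codes t ⌝
    roundsᴿ⇓ zero    = prec⇓₀ (comp⇓ (proj⇓ ∷ zero⇓ ∷ []) (consᴿ⇓ c₀ []))
    roundsᴿ⇓ (suc t) = prec⇓₁ (roundsᴿ⇓ t)
      (comp⇓ (proj⇓ ∷ proj⇓ ∷ proj⇓ ∷ []) (proj₁ (proj₂ (stepᴿ⇓ t (good t)))))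

    codes-mono : ∀ {t u} → t ≤′ u → codes t ⊆ᴸ codes u
    codes-mono ≤′-refl = id
    codes-mono (≤′-step {n = u} t≤u) c∈ =
      proj₁ (proj₂ (proj₂ (proj₂ (stepᴿ⇓ u (good u))))) (codes-mono t≤u c∈)

    next : ∀ t → Next t (codes t) (codes (suc t))
    next t = proj₂ (proj₂ (proj₂ (proj₂ (stepᴿ⇓ t (good t)))))

    Appears : ℕ → StateIdeal S → Set
    Appears t J = ∃ λ c → c ∈ᴸ codes t × c ⊩ J

    -- Round t accelerates along the word coded by the tail of the list coded
    -- by 1 + t, so that every word is used in arbitrarily late rounds.
    appears : ∀ {J} → Reachable (principal states x) J → ∃ λ t → Appears t J
    appears start = 0 , c₀ , here refl , c₀⊩
    appears {K} (fire {b} {J} r J⇒K) =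
      let t , c , c∈ , c⊩J = appears r in suc t , proj₁ (next t) c∈ {b} J K c⊩J J⇒K
    appears {K} (jump {b} {w} {J} r K-accel) with appears r
    ... | t , c , c∈ , c⊩J with ⌜∷⌝≡suc t (map toℕ (b ∷ w))
    ...   | u , eq =
      suc u , proj₂ (next u) t b w (sym eq) (codes-mono (≤⇒≤′ t≤u) c∈) J K c⊩J K-accel
      where
      t≤u : t ≤ u
      t≤u = s≤s⁻¹ (subst (t <_) eq (<-≤-trans (n<2^n t)
        (≤-trans (≤-reflexive (sym (*-identityʳ (2 ^ t)))) (*-monoʳ-≤ (2 ^ t) (s≤s z≤n)))))

    all-appear : ∀ Js → (∀ {J} → J ∈ᴸ Js → Reachable (principal states x) J) →
                 ∃ λ t → ∀ {J} → J ∈ᴸ Js → Appears t J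
    all-appear []       reach = 0 , λ ()
    all-appear (J ∷ Js) reach =
      let t , J-appears  = appears (reach (here refl))
          u , Js-appear = all-appear Js (λ J∈ → reach (there J∈))
      in t ⊔ u , λ
        { {K} (here refl) → coded-mono {J = K} (codes-mono (≤⇒≤′ (m≤m⊔n t u))) J-appears
        ; {K} (there K∈)  → coded-mono {J = K} (codes-mono (≤⇒≤′ (m≤n⊔m t u))) (Js-appear K∈) }

    Unstable : ℕ → Set₁
    Unstable t = Any (λ d → ¬ Any (d ⊑ᶜ_) (codes t)) (codes (suc t))

    unstableᴿ-decides : ∀ t → Decides unstableᴿ (t ∷ c₀ ∷ s ∷ []) (Unstable t)
    unstableᴿ-decides t = comp-decides
      (comp⇓ (comp⇓ (proj⇓ ∷ []) succ⇓ ∷ proj⇓ ∷ proj⇓ ∷ []) (roundsᴿ⇓ (suc t)) ∷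
       roundsᴿ⇓ t ∷ proj⇓ ∷ [])
      (anyᴿ-decides λ d∈ → notᴿ-decides (coveredᴿ-decides (coded (suc t) d∈) (coded t)))

    abstract
      -- Once the whole finite Karp-Miller family has appeared, its union covers `D`. Any ideal of
      -- the next round is included in `D`, hence by `ideal-prime` in a single member of the family,
      -- which is already listed.
      eventually-stable : ∃ λ t → ¬ Unstable t
      eventually-stable = t , λ unstable →
        let d , d∈ , uncovered   = find unstable
            J , d⊩J , J-sound    = All.lookup (good (suc t)) d∈
            K , K∈ , J⊑K         = find (ideal-prime J family (λ z∈J → covers (J-sound z∈J)))
            c , c∈ , c⊩K         = F-appears K∈
        in uncovered (lose c∈ (J , K , d⊩J , c⊩K , J⊑K))
        where
        open Terminates (terminates (principal states x))
        t : ℕ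
        t = proj₁ (all-appear family reachable)

        F-appears : ∀ {J} → J ∈ᴸ family → Appears t J
        F-appears = proj₂ (all-appear family reachable)

        inside : ∀ {J} → (family ▷ []) J → ∃ λ K → K ∈ᴸ family × J ⊑ K
        inside (K , inj₁ K∈ , J⊑K) = K , K∈ , J⊑K

        covers : ∀ {z} → z ∈ D → Any (λ J → z ∈ members J) family
        covers z∈D with inside {principal states x} root
        ... | I , I∈ , x⊑I =
          let K , K∈ , z∈K = closed-covers {G = _∈ᴸ family}
                (λ {b} J {K} J∈ J⇒K → inside {K} (closed {b} J {K} J∈ J⇒K)) I∈ (x⊑I ≲-refl) z∈D
          in lose K∈ z∈K

    module Stable (t : ℕ) (stable : ¬ Unstable t) where

      ideals : List (StateIdeal S)
      ideals = proj₁ (decode (good t))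

      decoded : Pointwise _⊩_ (codes t) ideals
      decoded = proj₂ (decode (good t))

      ideals-closed : Closed (_∈ᴸ ideals)
      ideals-closed {b} I {J} I∈ I⇒J =
        let c , c∈ , c⊩I   = Pointwise-left decoded I∈
            d , d∈ , d⊩J   = proj₁ (next t) c∈ {b} I J c⊩I I⇒J
            -- The successor is listed only in the following round; stability brings it back below
            -- an ideal of round `t`.
            e , e∈ , d⊑e   = find (decidable-stable lem λ uncovered → stable (lose d∈ uncovered))
            K , K∈ , e⊩K   = Pointwise-right decoded e∈
        in K , K∈ , ⊑ᶜ⇒⊑ J K d⊩J e⊩K d⊑e

      ideals-cover : ∀ {z} → z ∈ D → Any (λ J → z ∈ members J) ideals
      ideals-cover z∈D =
        -- The initial code `c₀` is never discarded, and whatever ideal it was decoded to equals the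
        -- principal ideal of `x`.
        let I , I∈ , c₀⊩I = Pointwise-right decoded (codes-mono (≤⇒≤′ (z≤n {t})) (here refl))
            K , K∈ , z∈K  = closed-covers {G = _∈ᴸ ideals} (λ {b} → ideals-closed {b}) I∈
                              (proj₁ (functional c₀⊩ c₀⊩I) ≲-refl) z∈D
        in lose K∈ z∈K

      below : ∀ K → members K ⊆ D → ∃₂ λ c J → c ∈ᴸ codes t × c ⊩ J × K ⊑ J
      below K K⊆D =
        let J , J∈ , K⊑J = find (ideal-prime K ideals (λ z∈K → ideals-cover (K⊆D z∈K)))
            c , c∈ , c⊩J = Pointwise-left decoded J∈
        in c , J , c∈ , c⊩J , K⊑J

      maximal⇒undominated : ∀ J → J ∈ IdealDecomposition states D →
        ∃₂ λ c K → c ∈ᴸ codes t × c ⊩ K × members J ≐ members K × ¬ Dominated (codes t) c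
      maximal⇒undominated J (J⊆D , max) =
        let c , K , c∈ , c⊩K , J⊑K = below J J⊆D
            K⊑J = max K (good-sound K (All.lookup (good t) c∈) c⊩K) J⊑K
        in c , K , c∈ , c⊩K , (J⊑K , K⊑J) , λ dominated →
          let d , d∈ , c⊑d , d⋢c = find dominated
              L , d⊩L , L-sound  = All.lookup (good t) d∈
              K⊑L = ⊑ᶜ⇒⊑ K L c⊩K d⊩L c⊑d
              L⊑J = max L L-sound (λ z∈ → K⊑L (J⊑K z∈))
          in d⋢c (L , K , d⊩L , c⊩K , λ z∈ → J⊑K (L⊑J z∈))

      -- An ideal of `D` above `J` lies in a listed ideal `L`, so comparing `J` with the list
      -- suffices: `L` includes `J` without dominating it, hence `L` is included in `J`.
      undominated⇒maximal : ∀ {c} J → c ∈ᴸ codes t → c ⊩ J → ¬ Dominated (codes t) c →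
        J ∈ IdealDecomposition states D
      undominated⇒maximal {c} J c∈ c⊩J undominated =
        good-sound J (All.lookup (good t) c∈) c⊩J , λ K K⊆D J⊑K →
          let d , L , d∈ , d⊩L , K⊑L = below K K⊆D
              d⊑c = decidable-stable lem λ d⋢c →
                undominated (lose d∈ ((J , L , c⊩J , d⊩L , λ z∈ → K⊑L (J⊑K z∈)) , d⋢c))
              L⊑J = ⊑ᶜ⇒⊑ L J d⊩L c⊩J d⊑c
          in λ z∈ → L⊑J (K⊑L z∈)

      maximaᴿ⇓ : ComputesFiniteSet maximaᴿ (⌜ codes t ⌝ ∷ s ∷ []) (IdealDecomposition states D)
      maximaᴿ⇓ = collect (filterᴿ⇓
        {f = notᴿ dominatedᴿ} {⌜ codes t ⌝ ∷ s ∷ []} {codes t} {Undominated}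
        λ c∈ → notᴿ-decides (dominatedᴿ-decides (coded t c∈) (coded t)))
        where
        Undominated : ℕ → Set₁
        Undominated c = ¬ Dominated (codes t) c

        collect : (∃ λ ms →
                    filterᴿ (notᴿ dominatedᴿ) [ ⌜ codes t ⌝ ∷ ⌜ codes t ⌝ ∷ s ∷ [] ]⇓ ⌜ ms ⌝ ×
                    (∀ {m} → m ∈ᴸ ms → m ∈ᴸ codes t × Undominated m) ×
                    (∀ {m} → m ∈ᴸ codes t → Undominated m → m ∈ᴸ ms)) →
                  ComputesFiniteSet maximaᴿ (⌜ codes t ⌝ ∷ s ∷ []) (IdealDecomposition states D)
        collect (ms , f⇓ , from , to) =
          ms , Js , comp⇓ (proj⇓ ∷ proj⇓ ∷ proj⇓ ∷ []) f⇓ , ms⊩Js ,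
          λ J → mk⇔ (present J) (maximal J)
          where
          decoding : ∃ λ Js → Pointwise _⊩_ ms Js
          decoding = decode (All.tabulate (λ m∈ → All.lookup (good t) (proj₁ (from m∈))))

          Js : List (StateIdeal S)
          Js = proj₁ decoding

          ms⊩Js : Pointwise _⊩_ ms Js
          ms⊩Js = proj₂ decoding

          present : ∀ J → J ∈ IdealDecomposition states D → Any (λ K → members J ≐ members K) Js
          present J J-max =
            let c , K , c∈ , c⊩K , J≈K , undominated = maximal⇒undominated J J-max
                L , L∈ , c⊩L = Pointwise-right ms⊩Js (to c∈ undominated)
                K≈L = functional c⊩K c⊩L
            in lose L∈ ((λ z∈ → proj₁ K≈L (proj₁ J≈K z∈)) , λ z∈ → proj₂ J≈K (proj₂ K≈L z∈))

          maximal : ∀ J → Any (λ K → members J ≐ members K) Js → J ∈ IdealDecomposition states D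
          maximal J J∈ =
            let K , K∈ , J≈K = find J∈
                m , m∈ , m⊩K = Pointwise-left ms⊩Js K∈
                m∈′ , undominated = from m∈
            in undominated⇒maximal J m∈′ (⊩-resp (proj₂ J≈K , proj₁ J≈K) m⊩K) undominated

    stableᴿ⇓ : ∃ λ t → stableᴿ [ c₀ ∷ s ∷ [] ]⇓ ⌜ codes t ⌝ × ¬ Unstable t
    stableᴿ⇓ = finish
      (min⇓-decides {f = unstableᴿ} {c₀ ∷ s ∷ []} {Unstable} unstableᴿ-decides
        (proj₁ eventually-stable) (proj₂ eventually-stable))
      where
      finish : (∃ λ t → min unstableᴿ [ c₀ ∷ s ∷ [] ]⇓ t × ¬ Unstable t) →
               ∃ λ t → stableᴿ [ c₀ ∷ s ∷ [] ]⇓ ⌜ codes t ⌝ × ¬ Unstable t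
      finish (t , min⇓t , stable) = t , comp⇓ (min⇓t ∷ proj⇓ ∷ proj⇓ ∷ []) (roundsᴿ⇓ t) , stable

  module _ {c} (c⊩x : codesState i c x) where

    clover⇓ : ComputesFiniteSet clover (s ∷ c ∷ []) (IdealDecomposition states D)
    clover⇓ = saturate (principalCode⇓ s⊩i c⊩x)
      where
      saturate : Computes principalCode (s ∷ c ∷ [])
                   (λ J → members J ≐ members (principal states x)) →
                 ComputesFiniteSet clover (s ∷ c ∷ []) (IdealDecomposition states D)
      saturate (c₀ , J , f⇓ , c₀⊩J , J≈x) = maximize stableᴿ⇓
        where
        open Saturation (⊩-resp J≈x c₀⊩J)

        maximize : (∃ λ t → stableᴿ [ c₀ ∷ s ∷ [] ]⇓ ⌜ codes t ⌝ × ¬ Unstable t) →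
                   ComputesFiniteSet clover (s ∷ c ∷ []) (IdealDecomposition states D)
        maximize (t , g⇓ , stable) =
          let ms , Js , h⇓ , rest = Stable.maximaᴿ⇓ t stable
          in ms , Js , comp⇓ (comp⇓ (f⇓ ∷ proj⇓ ∷ []) g⇓ ∷ proj⇓ ∷ []) h⇓ , rest

    -- `y` is coverable exactly when its principal ideal is included in `D`, and then that ideal
    -- lies in a single maximal one. One inclusion test against each ideal of the decomposition
    -- therefore decides the problem.
    coverable-decides : ∀ {d y} → codesState i d y →
      Decides coverable (s ∷ c ∷ d ∷ []) (Coverable x y)
    coverable-decides {d} {y} d⊩y = search (principalCode⇓ s⊩i d⊩y) clover⇓
      where
      search : Computes principalCode (s ∷ d ∷ [])
                 (λ J → members J ≐ members (principal states y)) →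
               ComputesFiniteSet clover (s ∷ c ∷ []) (IdealDecomposition states D) →
               Decides coverable (s ∷ c ∷ d ∷ []) (Coverable x y)
      search (e , I , f⇓ , e⊩I , I≈y) (ms , Js , g⇓ , ms⊩Js , Js-max) = Decides-cong to from
        (comp-decides (comp⇓ (proj⇓ ∷ proj⇓ ∷ []) f⇓ ∷ comp⇓ (proj⇓ ∷ proj⇓ ∷ []) g⇓ ∷ proj⇓ ∷ [])
          (coveredᴿ-decides {cs = ms} (I , e⊩I)
            λ m∈ → let K , _ , m⊩K = Pointwise-right ms⊩Js m∈ in K , m⊩K))
        where
        to : Any (e ⊑ᶜ_) ms → Coverable x y
        to covered =
          let m , m∈ , e⊑m = find covered
              K , K∈ , m⊩K = Pointwise-right ms⊩Js m∈
              K⊆D , _ = Equivalence.from (Js-max K) (lose K∈ (id , id))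
              z , z∈Post* , y≲z = K⊆D (⊑ᶜ⇒⊑ I K e⊩I m⊩K e⊑m (proj₂ I≈y ≲-refl))
          in z , y≲z , z∈Post*

        from : Coverable x y → Any (e ⊑ᶜ_) ms
        from (z , y≲z , z∈Post*) =
          let J , y⊑J , J-max = maximal-above {D} (principal states y)
                                  (λ u≲y → z , z∈Post* , ≲-trans u≲y y≲z)
              K , K∈ , J≈K = find (Equivalence.to (Js-max J) J-max)
              m , m∈ , m⊩K = Pointwise-left ms⊩Js K∈
          in lose m∈ (I , K , e⊩I , m⊩K , λ u∈ → proj₁ J≈K (y⊑J (proj₁ I≈y u∈)))

theorem12 : ExcludedMiddle (lsuc 0ℓ) →
    (𝒞 : SystemClass) →
    (∀ i → IsVeryWSTS (SystemClass.system 𝒞 i)) →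
    (E : CompletionPostEffective 𝒞) →
    ∞-CompletionEffective 𝒞 E →
    CoverDecompositionComputable 𝒞 E × CoverabilityDecidable 𝒞
theorem12 lem 𝒞 very E A =
  (clover , λ {s} {i} {c} {x} s⊩i c⊩x → Correctness.clover⇓ lem 𝒞 E A i (very i) s s⊩i x c⊩x) ,
  (coverable , λ {s} {i} {c} {d} {x} {y} s⊩i c⊩x d⊩y →
    Correctness.coverable-decides lem 𝒞 E A i (very i) s s⊩i x c⊩x d⊩y)
  where
  open SystemClass 𝒞 using (alphabet)
  open CompletionPostEffective E
  open ∞-CompletionEffective A
  open Algorithm alphabet post accelerate inclusion principalCode
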